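{- Every $2$-connected $\{K_{1,3}^{**},Z_1\}$-free graph has a longest cycle which is a dominating cycle of the graph.
   Context: All graphs are finite and simple. A cycle $C$ in a graph $G$ is dominating if every edge of $G$ has at least one end vertex on $C$. $G$ is $\{K_{1,3}^{**},Z_1\}$-free if it contains neither graph as an induced subgraph. $K_{1,3}^{*}$ is the graph obtained from the claw $K_{1,3}$ by subdividing each edge once, and $K_{1,3}^{**}$ is obtained from $K_{1,3}^{*}$ by deleting one vertex of degree $1$ (so it has a center with three neighbors, two of which carry a further pendant vertex). $Z_1$ is a triangle with one pendant vertex attached. -}

module Defs where

open import Data.Nat using (ℕ; zero; suc; _≤_)
open import Data.Fin using (Fin; toℕ; zero; suc)
open import Data.Bool using (Bool; true; false; T; _∨_)
open import Data.Bool.Properties using (∨-comm)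
open import Data.Product using (Σ; ∃; _×_; _,_)
open import Data.Sum using (_⊎_)
open import Data.Empty using (⊥)
open import Relation.Nullary using (¬_; Dec)
open import Relation.Binary.PropositionalEquality using (_≡_; _≢_; refl; subst)
open import Function.Definitions using (Injective)

record Graph : Set₁ where
  field
    n      : ℕ
    Adj    : Fin n → Fin n → Set
    sym    : ∀ {u v} → Adj u v → Adj v u
    irrefl : ∀ {u} → ¬ Adj u u
    dec    : ∀ u v → Dec (Adj u v)

open Graph public

data Reach (G : Graph) (P : Fin (n G) → Set) : Fin (n G) → Fin (n G) → Set where
  here : ∀ {u} → P u → Reach G P u u
  step : ∀ {u w v} → P u → Adj G u w → Reach G P w v → Reach G P u v

Connected : Graph → Set
Connected G = ∀ u v → Reach G (λ _ → Data.Unit.⊤) u v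
  where import Data.Unit

TwoConnected : Graph → Set
TwoConnected G =
  (3 ≤ n G) × Connected G ×
  (∀ x u v → u ≢ x → v ≢ x → Reach G (λ w → w ≢ x) u v)

InducedSub : Graph → Graph → Set
InducedSub H G =
  Σ (Fin (n H) → Fin (n G)) λ f →
    Injective _≡_ _≡_ f × (∀ a b → (Adj H a b → Adj G (f a) (f b)) × (Adj G (f a) (f b) → Adj H a b))

private
  loopFree : ∀ {m} (e : ℕ → ℕ → Bool) → (∀ k → e k k ≡ false) → (u : Fin m) → ¬ T (e (toℕ u) (toℕ u) ∨ e (toℕ u) (toℕ u))
  loopFree e h u t rewrite h (toℕ u) = t

  symT : ∀ {m} (e : ℕ → ℕ → Bool) {u v : Fin m} → T (e (toℕ u) (toℕ v) ∨ e (toℕ v) (toℕ u)) → T (e (toℕ v) (toℕ u) ∨ e (toℕ u) (toℕ v))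
  symT e {u} {v} t = subst T (∨-comm (e (toℕ u) (toℕ v)) (e (toℕ v) (toℕ u))) t

fromEdges : (m : ℕ) (e : ℕ → ℕ → Bool) → (∀ k → e k k ≡ false) → Graph
fromEdges m e h = record
  { n = m
  ; Adj = λ u v → T (e (toℕ u) (toℕ v) ∨ e (toℕ v) (toℕ u))
  ; sym = λ {u} {v} → symT e {u} {v}
  ; irrefl = λ {u} → loopFree e h u
  ; dec = λ u v → Data.Bool.T? _
  }
  where import Data.Bool

-- K_{1,3}^{**}: center 0; neighbours 1,2,3; pendant 4 at 1, pendant 5 at 2
k13e : ℕ → ℕ → Bool
k13e 0 1 = true
k13e 0 2 = true
k13e 0 3 = true
k13e 1 4 = true
k13e 2 5 = true
k13e _ _ = false

k13e-loop : ∀ k → k13e k k ≡ false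
k13e-loop 0 = refl
k13e-loop 1 = refl
k13e-loop 2 = refl
k13e-loop (suc (suc (suc k))) = refl

K13** : Graph
K13** = fromEdges 6 k13e k13e-loop

-- Z_1: triangle 0,1,2 with pendant vertex 3 attached to 0
z1e : ℕ → ℕ → Bool
z1e 0 1 = true
z1e 1 2 = true
z1e 0 2 = true
z1e 0 3 = true
z1e _ _ = false

z1e-loop : ∀ k → z1e k k ≡ false
z1e-loop 0 = refl
z1e-loop 1 = refl
z1e-loop 2 = refl
z1e-loop (suc (suc (suc k))) = refl

Z1 : Graph
Z1 = fromEdges 4 z1e z1e-loop

Free : Graph → Graph → Set
Free H G = ¬ InducedSub H G

record Cycle (G : Graph) : Set where
  field
    len     : ℕ
    len≥3   : 3 ≤ len
    vert    : Fin len → Fin (n G)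
    inj     : Injective _≡_ _≡_ vert
    next    : ∀ (i : Fin len) → (j : Fin len) → suc (toℕ i) ≡ toℕ j → Adj G (vert i) (vert j)
    close   : ∀ (i j : Fin len) → suc (toℕ i) ≡ len → toℕ j ≡ 0 → Adj G (vert i) (vert j)

open Cycle public

OnCycle : ∀ {G} → Cycle G → Fin (n G) → Set
OnCycle C v = ∃ λ i → vert C i ≡ v

Longest : ∀ {G} → Cycle G → Set
Longest {G} C = ∀ (D : Cycle G) → len D ≤ len C

Dominating : ∀ {G} → Cycle G → Set
Dominating {G} C = ∀ u v → Adj G u v → OnCycle C u ⊎ OnCycle C v

{-# OPTIONS --safe #-}
module Submission where

open import Defs
open import Data.Empty using (⊥; ⊥-elim)
open import Data.Fin using (Fin; zero; suc; toℕ; fromℕ)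
import Data.Fin as Fin
import Data.Fin.Properties as Finₚ
open import Data.List using (List; []; _∷_; _++_; [_]; length; lookup; tabulate; filter; allFin)
open import Data.List.Properties using (length-++; length-tabulate)
open import Data.List.Membership.Propositional using (_∈_; _∉_)
open import Data.List.Membership.Propositional.Properties
  using (∈-++⁺ˡ; ∈-++⁺ʳ; ∈-++⁻; ∈-lookup; ∈-allFin)
import Data.List.Membership.DecPropositional as DecMembership
open import Data.List.Relation.Unary.Any as Any using (here; there)
open import Data.List.Relation.Unary.Any.Properties using (lookup-index)
open import Data.List.Relation.Unary.All as All using (All; []; _∷_)
open import Data.List.Relation.Unary.AllPairs using ([]; _∷_)
open import Data.List.Relation.Unary.Unique.Propositional using (Unique)
open import Data.List.Relation.Unary.Unique.Propositional.Properties using (tabulate⁺)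
import Data.List.Relation.Unary.Unique.DecPropositional as DecUnique
open import Data.List.Relation.Binary.Permutation.Propositional
  using (_↭_; ↭⇒↭ₛ; ↭-refl; ↭-sym; ↭-trans; ↭-prep)
open import Data.List.Relation.Binary.Permutation.Propositional.Properties
  using (∈-resp-↭; ↭-length; ++⁺; ++⁺ˡ; ++⁺ʳ; ++-comm; ++-commutativeMonoid)
import Data.List.Relation.Binary.Permutation.Setoid.Properties as SetoidPerm
open import Data.Nat using (ℕ; zero; suc; _+_; _*_; _∸_; _≤_; _<_; z≤n; s≤s)
import Data.Nat.Properties as ℕₚ
open import Data.Nat.Induction using (<-rec)
open import Data.Product using (Σ; ∃; ∃₂; _×_; _,_; proj₁; proj₂)
open import Data.Sum using (_⊎_; inj₁; inj₂)
open import Data.Unit using (tt)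
open import Function using (_∘_; case_of_)
open import Relation.Nullary using (¬_; Dec; yes; no; _×-dec_; _→-dec_)
open import Relation.Nullary.Decidable using (map′; from-yes; decidable-stable)
open import Relation.Unary using (Decidable)
open import Relation.Binary using (Symmetric; DecidableEquality; tri<; tri≈; tri>)
open import Relation.Binary.PropositionalEquality
  using (_≡_; _≢_; refl; trans; cong; subst; setoid) renaming (sym to ≡-sym)
import Algebra.Solver.CommutativeMonoid as CMSolver

-- A paw-free connected graph with a triangle is complete multipartite, so every vertex sees an end of
-- every edge, and an edge off a longest cycle could be inserted into it. Assume there is no triangle;
-- then the vertices of a claw with two legs extended always span a further edge. Among the longest
-- cycles take C with the fewest vertices off C having a neighbour off C, and suppose an edge avoids C.
-- * A vertex h with a neighbour off C has at most one neighbour on C: if it had two, C could be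
--   lengthened, or h exchanged for a vertex of C with no neighbour off C.
-- * By 2-connectedness a path P off C joins distinct a, b on C. If P is shortest possible, a and b are
--   the only vertices of C adjacent to the first or last two vertices of P. The absence of K13** then
--   makes the distance classes of C − b from a independent, with consecutive classes completely
--   joined, and puts both neighbours of b on C into the same class.
-- * In such a layered structure, rotations turn the path left of C after deleting an edge at a (and,
--   when the parity is wrong, also the other end of that edge) into a path from a to b on the same
--   vertices. P has at least two vertices, so it closes this path to a cycle longer than C.

-- Walks, trails and lists without repetition.

data Walk {A : Set} (E : A → A → Set) : A → List A → A → Set where
  stop : ∀ {x} → Walk E x (x ∷ []) x
  _∷_  : ∀ {x y z l} → E x y → Walk E y l z → Walk E x (x ∷ l) z

-- The vertices of a trail are recorded only up to order, so that reversing one leaves its type alone.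
Trail : {A : Set} (E : A → A → Set) → A → List A → A → Set
Trail E x l y = ∃ λ l₀ → Walk E x l₀ y × l₀ ↭ l

module _ {A : Set} {E : A → A → Set} where

  start∈ : ∀ {x l y} → Walk E x l y → x ∈ l
  start∈ stop    = here refl
  start∈ (_ ∷ _) = here refl

  end∈ : ∀ {x l y} → Walk E x l y → y ∈ l
  end∈ stop    = here refl
  end∈ (_ ∷ w) = there (end∈ w)

  joinʷ : ∀ {x l y y′ l′ z} → Walk E x l y → E y y′ → Walk E y′ l′ z → Walk E x (l ++ l′) z
  joinʷ stop     e w′ = e ∷ w′
  joinʷ (e₀ ∷ w) e w′ = e₀ ∷ joinʷ w e w′

  mapʷ : ∀ {F : A → A → Set} {x l y} → (∀ {u v} → u ∈ l → v ∈ l → E u v → F u v) →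
         Walk E x l y → Walk F x l y
  mapʷ f stop    = stop
  mapʷ f (e ∷ w) = f (here refl) (there (start∈ w)) e ∷ mapʷ (λ p q → f (there p) (there q)) w

  splitʷ : ∀ {x l y b} → Walk E x l y → b ∈ l → b ≢ x →
           ∃₂ λ l₁ l₂ → ∃ λ u → Walk E x l₁ u × E u b × Walk E b l₂ y × l ≡ l₁ ++ l₂
  splitʷ stop    (here b≡x) b≢x = ⊥-elim (b≢x b≡x)
  splitʷ (e ∷ w) (here b≡x) b≢x = ⊥-elim (b≢x b≡x)
  splitʷ {x} {b = b} (e ∷ w) (there b∈) b≢x = go e w b∈
    where
    go : ∀ {x l y y′} → E x y → Walk E y l y′ → b ∈ l →
         ∃₂ λ l₁ l₂ → ∃ λ u → Walk E x l₁ u × E u b × Walk E b l₂ y′ × x ∷ l ≡ l₁ ++ l₂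
    go e stop     (here refl) = _ , _ , _ , stop , e , stop , refl
    go e (e′ ∷ w) (here refl) = _ , _ , _ , stop , e , (e′ ∷ w) , refl
    go e (e′ ∷ w) (there b∈) with go e′ w b∈
    ... | l₁ , l₂ , u , w₁ , f , w₂ , eq = _ , _ , _ , (e ∷ w₁) , f , w₂ , cong (_ ∷_) eq

  trail : ∀ {x l y} → Walk E x l y → Trail E x l y
  trail w = _ , w , ↭-refl

  point : ∀ x → Trail E x [ x ] x
  point x = trail stop

  infixr 5 _⟨_⟩_
  _⟨_⟩_ : ∀ {x l y y′ l′ z} → Trail E x l y → E y y′ → Trail E y′ l′ z → Trail E x (l ++ l′) z
  (_ , w , p) ⟨ e ⟩ (_ , w′ , p′) = _ , joinʷ w e w′ , ++⁺ p p′

  permute : ∀ {x l l′ y} → l ↭ l′ → Trail E x l y → Trail E x l′ y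
  permute q (_ , w , p) = _ , w , ↭-trans p q

  mapᵗ : ∀ {F : A → A → Set} {x l y} → (∀ {u v} → u ∈ l → v ∈ l → E u v → F u v) →
         Trail E x l y → Trail F x l y
  mapᵗ f (_ , w , p) = _ , mapʷ (λ i j → f (∈-resp-↭ p i) (∈-resp-↭ p j)) w , p

  first∈ : ∀ {x l y} → Trail E x l y → x ∈ l
  first∈ (_ , w , p) = ∈-resp-↭ p (start∈ w)

  last∈ : ∀ {x l y} → Trail E x l y → y ∈ l
  last∈ (_ , w , p) = ∈-resp-↭ p (end∈ w)

  nonempty : ∀ {x l y} → Trail E x l y → 0 < length l
  nonempty (_ , stop    , p) = ℕₚ.≤-reflexive (↭-length p)
  nonempty (_ , (_ ∷ _) , p) = ℕₚ.≤-trans (s≤s z≤n) (ℕₚ.≤-reflexive (↭-length p))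

  singleton : ∀ {x l y} → Trail E x l y → length l ≡ 1 → l ≡ [ x ]
  singleton t eq with first∈ t
  singleton {l = _ ∷ []} t eq | here refl = refl

  reverseᵗ : Symmetric E → ∀ {x l y} → Trail E x l y → Trail E y l x
  reverseᵗ s (_ , w , p) = permute p (go w)
    where
    go : ∀ {x l y} → Walk E x l y → Trail E y l x
    go stop    = point _
    go (e ∷ w) = permute (++-comm _ [ _ ]) (go w ⟨ s e ⟩ point _)

  uncons : ∀ {x l y} → Trail E x l y →
           (x ≡ y × length l ≡ 1) ⊎ ∃₂ λ x′ l′ → E x x′ × Trail E x′ l′ y × l ↭ x ∷ l′
  uncons (_ , stop    , p) = inj₁ (refl , ≡-sym (↭-length p))
  uncons (_ , (e ∷ w) , p) = inj₂ (_ , _ , e , trail w , ↭-sym p)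

  unsnoc : Symmetric E → ∀ {x l y} → Trail E x l y →
           (x ≡ y × length l ≡ 1) ⊎ ∃₂ λ y′ l′ → Trail E x l′ y′ × E y′ y × l ↭ y ∷ l′
  unsnoc s t with uncons (reverseᵗ s t)
  ... | inj₁ (refl , q)             = inj₁ (refl , q)
  ... | inj₂ (y′ , l′ , e , t′ , p) = inj₂ (y′ , l′ , reverseᵗ s t′ , s e , p)

module _ {A : Set} where

  Unique-resp-↭ : {l l′ : List A} → l ↭ l′ → Unique l → Unique l′
  Unique-resp-↭ p = SetoidPerm.Unique-resp-↭ (setoid A) (↭⇒↭ₛ p)

  Unique-++ʳ : ∀ (l : List A) {l′} → Unique (l ++ l′) → Unique l′
  Unique-++ʳ []      u       = u
  Unique-++ʳ (x ∷ l) (_ ∷ u) = Unique-++ʳ l u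

  Unique-∷ : {x : A} {l : List A} → x ∉ l → Unique l → Unique (x ∷ l)
  Unique-∷ x∉ u = All.tabulate (λ { i refl → x∉ i }) ∷ u

  Unique-head : {x : A} {l : List A} → Unique (x ∷ l) → x ∉ l
  Unique-head (a ∷ _) i = All.lookup a i refl

  Unique-join : {l l′ : List A} → Unique l → Unique l′ → (∀ {v} → v ∈ l → v ∉ l′) → Unique (l ++ l′)
  Unique-join []      u′ d = u′
  Unique-join (a ∷ u) u′ d =
    Unique-∷ (λ i → case-∈ (∈-++⁻ _ i)) (Unique-join u u′ (λ i → d (there i)))
    where
    case-∈ : _ ∈ _ ⊎ _ ∈ _ → ⊥
    case-∈ (inj₁ i) = All.lookup a i refl
    case-∈ (inj₂ i) = d (here refl) i

module _ {A : Set} {E : A → A → Set} (_≟_ : DecidableEquality A) where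

  open DecMembership _≟_ using (_∈?_)

  eraseLoops : ∀ {x l y} → Walk E x l y →
               ∃ λ l′ → Walk E x l′ y × Unique l′ × (∀ {v} → v ∈ l′ → v ∈ l)
  eraseLoops stop = _ , stop , ([] ∷ []) , λ i → i
  eraseLoops {x} (_∷_ {y = y} e w) with eraseLoops w
  ... | l′ , w′ , u , sub with x ∈? l′
  ...   | no x∉ = _ , (e ∷ w′) , Unique-∷ x∉ u , λ { (here p) → here p ; (there i) → there (sub i) }
  ...   | yes x∈ with x ≟ y
  ...     | yes refl = _ , w′ , u , λ i → there (sub i)
  ...     | no x≢ with splitʷ w′ x∈ x≢
  ...       | l₁ , l₂ , _ , _ , _ , w₂ , refl =
                l₂ , w₂ , Unique-++ʳ l₁ u , λ i → there (sub (∈-++⁺ʳ l₁ i))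

-- Consequences of the two forbidden induced subgraphs.

TriangleFree : Graph → Set
TriangleFree G = ∀ {x y z} → x ~ y → y ~ z → x ~ z → ⊥
  where _~_ = Adj G

-- The legs are `c u u′`, `c w w′` and `c t`. Without triangles only five further pairs can be
-- edges, and an induced `K13**` is avoided exactly when one of them is. Four exclusions forcing the
-- fifth edge is the form in which this gets applied.
SpiderClosed : Graph → Set
SpiderClosed G = ∀ {c u u′ w w′ t} → c ~ u → u ~ u′ → c ~ w → w ~ w′ → c ~ t →
  ¬ u ~ w′ → ¬ u′ ~ w → ¬ u′ ~ w′ → ¬ u′ ~ t → w′ ~ t
  where _~_ = Adj G

-- Absence of twins. A map that preserves and reflects adjacency is then injective by itself, so the
-- distinctness of chosen vertices never has to be checked.
PointDetermining : Graph → Set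
PointDetermining H = ∀ a b → (∀ c → (Adj H a c → Adj H b c) × (Adj H b c → Adj H a c)) → a ≡ b

pointDetermining? : ∀ H → Dec (PointDetermining H)
pointDetermining? H = Finₚ.all? λ a → Finₚ.all? λ b →
  Finₚ.all? (λ c → (dec H a c →-dec dec H b c) ×-dec (dec H b c →-dec dec H a c)) →-dec (a Fin.≟ b)

module _ (H G : Graph) (f : Fin (n H) → Fin (n G)) where

  Agree : Fin (n H) → Fin (n H) → Set
  Agree a b = Adj H a b × Adj G (f a) (f b) ⊎ ¬ Adj H a b × ¬ Adj G (f a) (f b)

  induced : PointDetermining H → (∀ a b → toℕ a < toℕ b → Agree a b) → InducedSub H G
  induced pd upper = f , injective , λ a b → ⇒ (agree a b) , ⇐ (agree a b)
    where
    ⇒ : ∀ {a b} → Agree a b → Adj H a b → Adj G (f a) (f b)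
    ⇒ (inj₁ (_ , e)) _ = e
    ⇒ (inj₂ (e̸ , _)) e = ⊥-elim (e̸ e)
    ⇐ : ∀ {a b} → Agree a b → Adj G (f a) (f b) → Adj H a b
    ⇐ (inj₁ (e , _)) _ = e
    ⇐ (inj₂ (_ , e̸)) e = ⊥-elim (e̸ e)
    flip-agree : ∀ {a b} → Agree a b → Agree b a
    flip-agree (inj₁ (e , e′)) = inj₁ (sym H e , sym G e′)
    flip-agree (inj₂ (e , e′)) = inj₂ (e ∘ sym H , e′ ∘ sym G)
    agree : ∀ a b → Agree a b
    agree a b with ℕₚ.<-cmp (toℕ a) (toℕ b)
    ... | tri< a<b _ _ = upper a b a<b
    ... | tri> _ _ b<a = flip-agree (upper b a b<a)
    ... | tri≈ _ a≡b _ with Finₚ.toℕ-injective a≡b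
    ...   | refl = inj₂ (irrefl H , irrefl G)
    injective : ∀ {a b} → f a ≡ f b → a ≡ b
    injective {a} {b} fa≡fb = pd a b λ c →
      (λ e → ⇐ (agree b c) (subst (λ v → Adj G v (f c)) fa≡fb (⇒ (agree a c) e))) ,
      (λ e → ⇐ (agree a c) (subst (λ v → Adj G v (f c)) (≡-sym fa≡fb) (⇒ (agree b c) e)))

module _ (G : Graph) where

  private
    _~_ = Adj G

  pawless : Free Z1 G → ∀ {x y z w} → x ~ y → y ~ z → x ~ z → x ~ w → ¬ y ~ w → ¬ z ~ w → ⊥
  pawless free {x} {y} {z} {w} xy yz xz xw y≁w z≁w =
    free (induced Z1 G (lookup (x ∷ y ∷ z ∷ w ∷ [])) (from-yes (pointDetermining? Z1)) upper)
    where
    upper : ∀ a b → toℕ a < toℕ b → Agree Z1 G (lookup (x ∷ y ∷ z ∷ w ∷ [])) a b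
    upper zero (suc zero) _ = inj₁ (tt , xy)
    upper zero (suc (suc zero)) _ = inj₁ (tt , xz)
    upper zero (suc (suc (suc zero))) _ = inj₁ (tt , xw)
    upper (suc zero) (suc zero) (s≤s ())
    upper (suc zero) (suc (suc zero)) _ = inj₁ (tt , yz)
    upper (suc zero) (suc (suc (suc zero))) _ = inj₂ ((λ ()) , y≁w)
    upper (suc (suc a)) (suc zero) (s≤s ())
    upper (suc (suc zero)) (suc (suc zero)) (s≤s (s≤s ()))
    upper (suc (suc zero)) (suc (suc (suc zero))) _ = inj₂ ((λ ()) , z≁w)
    upper (suc (suc (suc zero))) (suc (suc zero)) (s≤s (s≤s ()))
    upper (suc (suc (suc zero))) (suc (suc (suc zero))) (s≤s (s≤s (s≤s ())))

  spider-closed : Free K13** G → TriangleFree G → SpiderClosed G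
  spider-closed free triangle-free {c} {u} {u′} {w} {w′} {t} cu uu′ cw ww′ ct u≁w′ u′≁w u′≁w′ u′≁t =
    decidable-stable (dec G w′ t) λ w′≁t →
      free (induced K13** G vertices (from-yes (pointDetermining? K13**)) (upper w′≁t))
    where
    vertices : Fin 6 → Fin (n G)
    vertices = lookup (c ∷ u ∷ w ∷ t ∷ u′ ∷ w′ ∷ [])
    upper : ¬ w′ ~ t → ∀ a b → toℕ a < toℕ b → Agree K13** G vertices a b
    upper _ zero (suc zero) _ = inj₁ (tt , cu)
    upper _ zero (suc (suc zero)) _ = inj₁ (tt , cw)
    upper _ zero (suc (suc (suc zero))) _ = inj₁ (tt , ct)
    upper _ zero (suc (suc (suc (suc zero)))) _ = inj₂ ((λ ()) , triangle-free cu uu′)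
    upper _ zero (suc (suc (suc (suc (suc zero))))) _ = inj₂ ((λ ()) , triangle-free cw ww′)
    upper _ (suc zero) (suc (suc zero)) _ = inj₂ ((λ ()) , λ e → triangle-free cu e cw)
    upper _ (suc zero) (suc (suc (suc zero))) _ = inj₂ ((λ ()) , λ e → triangle-free cu e ct)
    upper _ (suc zero) (suc (suc (suc (suc zero)))) _ = inj₁ (tt , uu′)
    upper _ (suc zero) (suc (suc (suc (suc (suc zero))))) _ = inj₂ ((λ ()) , u≁w′)
    upper _ (suc (suc zero)) (suc (suc (suc zero))) _ = inj₂ ((λ ()) , λ e → triangle-free cw e ct)
    upper _ (suc (suc zero)) (suc (suc (suc (suc zero)))) _ = inj₂ ((λ ()) , u′≁w ∘ sym G)
    upper _ (suc (suc zero)) (suc (suc (suc (suc (suc zero))))) _ = inj₁ (tt , ww′)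
    upper _ (suc (suc (suc zero))) (suc (suc (suc (suc zero)))) _ = inj₂ ((λ ()) , u′≁t ∘ sym G)
    upper w′≁t (suc (suc (suc zero))) (suc (suc (suc (suc (suc zero))))) _ = inj₂ ((λ ()) , w′≁t ∘ sym G)
    upper _ (suc (suc (suc (suc zero)))) (suc (suc (suc (suc (suc zero))))) _ = inj₂ ((λ ()) , u′≁w′)
    upper _ (suc _) (suc zero) (s≤s ())
    upper _ (suc (suc _)) (suc (suc zero)) (s≤s (s≤s ()))
    upper _ (suc (suc (suc _))) (suc (suc (suc zero))) (s≤s (s≤s (s≤s ())))
    upper _ (suc (suc (suc (suc _)))) (suc (suc (suc (suc zero)))) (s≤s (s≤s (s≤s (s≤s ()))))
    upper _ (suc (suc (suc (suc (suc zero))))) (suc (suc (suc (suc (suc zero))))) (s≤s (s≤s (s≤s (s≤s (s≤s ())))))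

  Sees : Fin (n G) → Fin (n G) → Fin (n G) → Fin (n G) → Set
  Sees w x y z = w ~ x × w ~ y ⊎ w ~ x × w ~ z ⊎ w ~ y × w ~ z

  module Multipartite (connected : Connected G) (free : Free Z1 G) where

    -- The property spreads along walks from `x`. A vertex seeing exactly one corner forms a paw
    -- with the triangle. One seeing no corner, but adjacent to some `v` that sees two, is pendant
    -- at `v` on the triangle of `v` and these two.
    sees-triangle : ∀ {x y z} → x ~ y → y ~ z → x ~ z → ∀ w → Sees w x y z
    sees-triangle {x} {y} {z} xy yz xz w = go (connected w x)
      where
      next-sees : ∀ {u v} → u ~ v → Sees v x y z → Sees u x y z
      next-sees {u} {v} uv sees with dec G u x | dec G u y | dec G u z
      ... | yes ux | yes uy | _      = inj₁ (ux , uy)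
      ... | yes ux | no _   | yes uz = inj₂ (inj₁ (ux , uz))
      ... | no _   | yes uy | yes uz = inj₂ (inj₂ (uy , uz))
      ... | yes ux | no u≁y | no u≁z = ⊥-elim (pawless free xy yz xz (sym G ux) (u≁y ∘ sym G) (u≁z ∘ sym G))
      ... | no u≁x | yes uy | no u≁z = ⊥-elim (pawless free (sym G xy) xz yz (sym G uy) (u≁x ∘ sym G) (u≁z ∘ sym G))
      ... | no u≁x | no u≁y | yes uz =
            ⊥-elim (pawless free (sym G xz) xy (sym G yz) (sym G uz) (u≁x ∘ sym G) (u≁y ∘ sym G))
      next-sees uv (inj₁ (vx , vy))        | no u≁x | no u≁y | no u≁z =
        ⊥-elim (pawless free vx xy vy (sym G uv) (u≁x ∘ sym G) (u≁y ∘ sym G))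
      next-sees uv (inj₂ (inj₁ (vx , vz))) | no u≁x | no u≁y | no u≁z =
        ⊥-elim (pawless free vx xz vz (sym G uv) (u≁x ∘ sym G) (u≁z ∘ sym G))
      next-sees uv (inj₂ (inj₂ (vy , vz))) | no u≁x | no u≁y | no u≁z =
        ⊥-elim (pawless free vy yz vz (sym G uv) (u≁y ∘ sym G) (u≁z ∘ sym G))
      go : ∀ {u P} → Reach G P u x → Sees u x y z
      go (here _)     = inj₂ (inj₂ (xy , xz))
      go (step _ e r) = next-sees e (go r)

    -- `u` lies in a triangle with two of the corners, and `v` sees one of these two, so `uv` lies
    -- in a triangle. Every `w` sees two of its corners, hence `u` or `v`.
    edge-dominates : ∀ {x y z} → x ~ y → y ~ z → x ~ z → ∀ {u v} → u ~ v → ∀ w → w ~ u ⊎ w ~ v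
    edge-dominates xy yz xz {u} {v} uv w with in-triangle
      where
      third : ∀ {p q} → u ~ p → p ~ q → u ~ q → ∃ λ t → u ~ t × v ~ t
      third {p} {q} up pq uq with sees-triangle up pq uq v
      ... | inj₁ (_ , vp)        = p , up , vp
      ... | inj₂ (inj₁ (_ , vq)) = q , uq , vq
      ... | inj₂ (inj₂ (vp , _)) = p , up , vp
      in-triangle : ∃ λ t → u ~ t × v ~ t
      in-triangle with sees-triangle xy yz xz u
      ... | inj₁ (ux , uy)        = third ux xy uy
      ... | inj₂ (inj₁ (ux , uz)) = third ux xz uz
      ... | inj₂ (inj₂ (uy , uz)) = third uy yz uz
    ... | t , ut , vt with sees-triangle uv vt ut w
    ...   | inj₁ (wu , _)        = inj₁ wu
    ...   | inj₂ (inj₁ (wu , _)) = inj₁ wu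
    ...   | inj₂ (inj₂ (wv , _)) = inj₂ wv

-- Least numbers, distance layers and rotations.

Least : (ℕ → Set) → ℕ → Set
Least P d = P d × (∀ {e} → e < d → ¬ P e)

least : ∀ {P : ℕ → Set} → Decidable P → ∀ {d} → P d → ∃ (Least P)
least {P} P? {d} = <-rec (λ d → P d → ∃ (Least P)) go d
  where
  go : ∀ d → (∀ {e} → e < d → P e → ∃ (Least P)) → P d → ∃ (Least P)
  go d rec p with ℕₚ.anyUpTo? P? d
  ... | yes (e , e<d , q) = rec e<d q
  ... | no none           = d , p , λ e<d q → none (_ , e<d , q)

module Layering (G : Graph) (U : Fin (n G) → Set) (U? : Decidable U) (root : Fin (n G)) (U-root : U root) where

  private
    V = Fin (n G)

  WalkTo : ℕ → V → Set
  WalkTo zero    v = v ≡ root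
  WalkTo (suc d) v = U v × ∃ λ u → WalkTo d u × Adj G u v

  walkTo? : ∀ d → Decidable (WalkTo d)
  walkTo? zero    v = v Fin.≟ root
  walkTo? (suc d) v = U? v ×-dec Finₚ.any? (λ u → walkTo? d u ×-dec dec G u v)

  -- Distance from `root` in the subgraph induced by `U`, kept as a relation so that a vertex out of
  -- reach needs no value.
  Level : ℕ → V → Set
  Level d v = Least (λ e → WalkTo e v) d

  level : ∀ {d v} → WalkTo d v → ∃ λ e → Level e v
  level {v = v} = least (λ e → walkTo? e v)

  level-U : ∀ {d v} → Level d v → U v
  level-U {zero}  (refl , _)    = U-root
  level-U {suc d} ((u , _) , _) = u

  level-≤ : ∀ {d e v} → Level d v → WalkTo e v → d ≤ e
  level-≤ (_ , min) w = ℕₚ.≮⇒≥ λ lt → min lt w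

  level-unique : ∀ {d e v} → Level d v → Level e v → d ≡ e
  level-unique p q = ℕₚ.≤-antisym (level-≤ p (proj₁ q)) (level-≤ q (proj₁ p))

  parent : ∀ {d v} → Level (suc d) v → ∃ λ u → Level d u × Adj G u v
  parent ((Uv , u , w , e) , min) = u , (w , λ lt w′ → min (s≤s lt) (Uv , u , w′ , e)) , e

  level-step : ∀ {d e u v} → Level d u → Level e v → Adj G u v → e ≤ suc d
  level-step p q uv = level-≤ q (level-U q , _ , proj₁ p , uv)

  walkTo-along : ∀ {d x l y} → Walk (Adj G) x l y → (∀ {v} → v ∈ l → U v) → WalkTo d x →
                 ∀ {v} → v ∈ l → ∃ λ e → WalkTo e v
  walkTo-along stop    f t (here refl) = _ , t
  walkTo-along (e ∷ w) f t (here refl) = _ , t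
  walkTo-along (e ∷ w) f t (there i)   =
    walkTo-along w (f ∘ there) (f (there (start∈ w)) , _ , t , e) i

-- Rotations of a path with one end fixed: its other end e is joined to an earlier vertex one level
-- higher whose successor lies two levels above e, and that successor becomes the new end.
module Rotations {A : Set} (_~_ : A → A → Set) (~-sym : Symmetric _~_) (ℓ : A → ℕ) (b : A)
  (complete : ∀ {x y} → suc (ℓ x) ≡ ℓ y → ℓ y < ℓ b → x ~ y) where

  -- The lower end must not be `b`, so walks enter and leave `b` only through the level just below
  -- it.
  Edge : A → A → Set
  Edge x y = x ~ y × (suc (ℓ x) ≡ ℓ y × x ≢ b ⊎ suc (ℓ y) ≡ ℓ x × y ≢ b)

  Edge-sym : Symmetric Edge
  Edge-sym (e , inj₁ p) = ~-sym e , inj₂ p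
  Edge-sym (e , inj₂ p) = ~-sym e , inj₁ p

  -- Levels change by one along an edge, so the first edge leaving the levels up to `m` rises from
  -- `m` to `suc m`.
  crossing : ∀ {x l e} m → Walk Edge x l e → b ∈ l → ℓ x ≤ m → m < ℓ b →
             ∃₂ λ l₁ l₂ → ∃₂ λ u u′ → Walk Edge x l₁ u × Edge u u′ × Walk Edge u′ l₂ e ×
             ℓ u ≡ m × ℓ u′ ≡ suc m × l ≡ l₁ ++ l₂
  crossing m stop    (here refl) ≤m m< = ⊥-elim (ℕₚ.<⇒≱ m< ≤m)
  crossing m (_ ∷ _) (here refl) ≤m m< = ⊥-elim (ℕₚ.<⇒≱ m< ≤m)
  crossing m (_∷_ {y = y} e w) (there b∈) ≤m m< with ℓ y ℕₚ.≤? m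
  ... | yes y≤m with crossing m w b∈ y≤m m<
  ...   | _ , _ , _ , _ , w₁ , f , w₂ , p , q , refl = _ , _ , _ , _ , e ∷ w₁ , f , w₂ , p , q , refl
  crossing m (e@(_ , inj₁ (up , _)) ∷ w) (there b∈) ≤m m< | no y≰m =
    _ , _ , _ , _ , stop , e , w , x≡m , trans (≡-sym up) (cong suc x≡m) , refl
    where
    x≡m = ℕₚ.≤-antisym ≤m (ℕₚ.≤-pred (subst (m <_) (≡-sym up) (ℕₚ.≰⇒> y≰m)))
  crossing m (e@(_ , inj₂ (down , _)) ∷ w) (there b∈) ≤m m< | no y≰m =
    ⊥-elim (y≰m (ℕₚ.≤-trans (ℕₚ.n≤1+n _) (subst (_≤ m) (≡-sym down) ≤m)))

  -- Each round lifts the free end by two levels. Once it is two below `b`, cutting just before `b`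
  -- makes `b` itself the end. The bound on `ℓ x` guarantees that the walk crosses the level above
  -- `e` on its way to `b`.
  rotate-to : ∀ k {x M e} → Trail Edge x M e → b ∈ M → x ≢ b → ℓ x ≤ suc (ℓ e) →
              ℓ b ≡ suc k * 2 + ℓ e → Trail Edge x M b
  rotate-to zero {e = e} (_ , w , p) b∈ x≢b _ eq with splitʷ w (∈-resp-↭ (↭-sym p) b∈) (x≢b ∘ ≡-sym)
  ... | _ , _ , u , w₁ , (_ , inj₂ (_ , b≢b)) , w₂ , refl = ⊥-elim (b≢b refl)
  ... | _ , _ , u , w₁ , (_ , inj₁ (ub , u≢b)) , w₂ , refl =
        permute p (trail w₁ ⟨ ~-sym (complete eu u<b) , inj₂ (eu , e≢b) ⟩ reverseᵗ Edge-sym (trail w₂))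
    where
    eu : suc (ℓ e) ≡ ℓ u
    eu = ℕₚ.suc-injective (≡-sym (trans ub eq))
    u<b : ℓ u < ℓ b
    u<b = ℕₚ.≤-reflexive ub
    e≢b : e ≢ b
    e≢b refl = ℕₚ.<⇒≢ (ℕₚ.m≤n⇒m≤1+n ℕₚ.≤-refl) eq
  rotate-to (suc k) {x} {e = e} (_ , w , p) b∈ x≢b x≤ eq
    with crossing (suc (ℓ e)) w (∈-resp-↭ (↭-sym p) b∈) x≤ 1+e<b
    where
    1+e<b : suc (ℓ e) < ℓ b
    1+e<b = subst (suc (ℓ e) <_) (≡-sym eq) (s≤s (s≤s (ℕₚ.m≤n+m _ (suc k * 2))))
  ... | _ , _ , u , u′ , w₁ , uu′ , w₂ , ℓu , ℓu′ , refl =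
        rotate-to k
          (permute p (trail w₁ ⟨ ~-sym (complete (≡-sym ℓu) u<b) , inj₂ (≡-sym ℓu , e≢b) ⟩
            reverseᵗ Edge-sym (trail w₂)))
          b∈ x≢b (ℕₚ.≤-trans x≤ (ℕₚ.≤-trans (ℕₚ.n≤1+n _) (ℕₚ.≤-trans (ℕₚ.≤-reflexive (≡-sym ℓu′)) (ℕₚ.n≤1+n _)))) eq′
    where
    u<b : ℓ u < ℓ b
    u<b = subst (ℓ u <_) (≡-sym eq) (subst (_< suc (suc k) * 2 + ℓ e) (≡-sym ℓu) (s≤s (s≤s (ℕₚ.m≤n+m _ (suc k * 2)))))
    e≢b : e ≢ b
    e≢b refl = ℕₚ.<⇒≢ (ℕₚ.m<n⇒m<1+n (s≤s (ℕₚ.m≤n+m _ (suc k * 2)))) eq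
    eq′ : ℓ b ≡ suc k * 2 + ℓ u′
    eq′ = trans eq (≡-sym (trans (cong (suc k * 2 +_) ℓu′)
      (trans (ℕₚ.+-suc (suc k * 2) _) (cong suc (ℕₚ.+-suc (suc k * 2) _)))))

-- Extremal cycles and detours.

module Optimality (G : Graph) where

  V : Set
  V = Fin (n G)

  infix 4 _~_ _≁_
  _~_ _≁_ : V → V → Set
  _~_ = Adj G
  u ≁ v = ¬ (u ~ v)

  Path : V → List V → V → Set
  Path = Trail _~_

  open CMSolver (++-commutativeMonoid {A = V}) public using (solve; _⊜_; _⊕_)

  ~⇒≢ : ∀ {u v} → u ~ v → u ≢ v
  ~⇒≢ e refl = irrefl G e

  -- A longest cycle on the vertex set l, with the consequence of minimising the number of vertices
  -- off the cycle that have a neighbour off the cycle.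
  record Optimal (l : List V) : Set where
    field
      unique   : Unique l
      size     : 3 ≤ length l
      longest  : ∀ {x l′ y} → Path x l′ y → y ~ x → Unique l′ → 3 ≤ length l′ → length l′ ≤ length l
      exchange : ∀ {h h′ w x y l′} → h ∉ l → h′ ∉ l → h ~ h′ → w ∈ l → Path x l′ y → y ~ x →
                 w ∷ l′ ↭ h ∷ l → (∀ z → z ∉ l → w ~ z → z ≡ h) → ⊥

  open Optimal

  Optimal-resp-↭ : ∀ {l l′} → l ↭ l′ → Optimal l → Optimal l′
  Optimal-resp-↭ {l} {l′} p o = record
    { unique   = Unique-resp-↭ p (unique o)
    ; size     = subst (3 ≤_) (↭-length p) (size o)
    ; longest  = λ t e u s → subst (_ ≤_) (↭-length p) (longest o t e u s)
    ; exchange = λ h∉ h′∉ hh′ w∈ t e q f →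
        exchange o (h∉ ∘ ∈-resp-↭ p) (h′∉ ∘ ∈-resp-↭ p) hh′ (∈-resp-↭ (↭-sym p) w∈) t e
          (↭-trans q (↭-prep _ (↭-sym p))) (λ z z∉ → f z (z∉ ∘ ∈-resp-↭ (↭-sym p)))
    }

  Off : List V → List V → Set
  Off l P = All (_∉ l) P

  -- Counting both sides of the permutation gives `M` more vertices than `l`, since less is dropped
  -- than added. Distinctness is inherited from `P ++ l`.
  longer : ∀ {l x M y} → Optimal l → Path x M y → y ~ x → ∀ lost P → lost ++ M ↭ P ++ l →
           Unique P → Off l P → length lost < length P → ⊥
  longer {l} {M = M} o t e lost P q uP off lt =
    ℕₚ.<⇒≱ l<M (longest o t e uM (ℕₚ.≤-trans (size o) (ℕₚ.<⇒≤ l<M)))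
    where
    uM : Unique M
    uM = Unique-++ʳ lost (Unique-resp-↭ (↭-sym q) (Unique-join uP (unique o) (All.lookup off)))
    sizes : length lost + length M ≡ length P + length l
    sizes = trans (≡-sym (length-++ lost)) (trans (↭-length q) (length-++ P))
    l<M : length l < length M
    l<M = ℕₚ.≰⇒> λ M≤l → ℕₚ.<-irrefl sizes (ℕₚ.+-mono-<-≤ lt M≤l)

  -- Closing the path through `P` pays as soon as `P` has more vertices than `M` leaves out of `l`.
  detour : ∀ {l x M y h P g} → Optimal l → Path x M y → Path h P g → y ~ h → g ~ x →
           Unique P → Off l P → ∀ lost → lost ++ M ↭ l → length lost < length P → ⊥
  detour {l} {M = M} {P = P} o t p e e′ uP off lost q lt =
    longer o (p ⟨ e′ ⟩ t) e lost P perm uP off lt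
    where
    perm : lost ++ (P ++ M) ↭ P ++ l
    perm = ↭-trans (solve 3 (λ a b c → a ⊕ (b ⊕ c) ⊜ b ⊕ (a ⊕ c)) ↭-refl lost P M) (++⁺ˡ P q)

  insert : ∀ {l x y h P g} → Optimal l → Path x l y → Path h P g → y ~ h → g ~ x →
           Unique P → Off l P → ⊥
  insert o t p e e′ uP off = detour o t p e e′ uP off [] ↭-refl (nonempty p)

  unique₂ : ∀ {x y : V} → x ~ y → Unique (x ∷ y ∷ [])
  unique₂ e = (~⇒≢ e ∷ []) ∷ [] ∷ []

  unique₃ : ∀ {x y z : V} → x ≢ y → x ≢ z → y ≢ z → Unique (x ∷ y ∷ z ∷ [])
  unique₃ a b c = (a ∷ b ∷ []) ∷ (c ∷ []) ∷ [] ∷ []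

-- Attachments of outside vertices in the triangle-free case.

module Clawless (G : Graph) (triangle-free : TriangleFree G) (spider : SpiderClosed G) where

  open Optimality G
  open Optimal

  private
    s : ∀ {u v} → u ~ v → v ~ u
    s = sym G

  module Attached {a q r p R} (o : Optimal (a ∷ q ∷ R)) (aq : a ~ q) (qr : q ~ r) (T : Path r R p) (pa : p ~ a)
    {h h′} (h∉ : h ∉ a ∷ q ∷ R) (h′∉ : h′ ∉ a ∷ q ∷ R) (hh′ : h ~ h′) (ha : h ~ a) where

    private
      whole : Path a (a ∷ q ∷ R) p
      whole = point a ⟨ aq ⟩ point q ⟨ qr ⟩ T

      from-q : Path q (a ∷ q ∷ R) a
      from-q = permute (++-comm (q ∷ R) [ a ]) (point q ⟨ qr ⟩ T ⟨ pa ⟩ point a)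

      h′≁q : h′ ≁ q
      h′≁q e = insert o from-q (point h ⟨ hh′ ⟩ point h′) (s ha) e (unique₂ hh′) (h∉ ∷ h′∉ ∷ [])

      h′≁p : h′ ≁ p
      h′≁p e = insert o whole (point h′ ⟨ s hh′ ⟩ point h) (s e) ha (unique₂ (s hh′)) (h′∉ ∷ h∉ ∷ [])

    -- The spider at `a` with legs `h h′`, `q z` and `p`: each of the four other edges would allow
    -- an insertion next to `a`.
    neighbours-off : ∀ z → z ∉ a ∷ q ∷ R → q ~ z → z ≢ h → p ~ z
    neighbours-off z z∉ qz z≢h =
      s (spider (s ha) hh′ aq qz (s pa) h≁z h′≁q h′≁z h′≁p)
      where
      h≁z : h ≁ z
      h≁z e = insert o from-q (point h ⟨ e ⟩ point z) (s ha) (s qz) (unique₂ e) (h∉ ∷ z∉ ∷ [])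
      h′≁z : h′ ≁ z
      h′≁z e = insert o from-q (point h ⟨ hh′ ⟩ point h′ ⟨ e ⟩ point z) (s ha) (s qz)
        (unique₃ (~⇒≢ hh′) (z≢h ∘ ≡-sym) (~⇒≢ e)) (h∉ ∷ h′∉ ∷ z∉ ∷ [])

    -- Otherwise `h` could take the place of `q`. Optimality forbids this if `h` is the only
    -- neighbour of `q` off the cycle. A further one `z` also sees `p`, and then `z q a h r … p` is
    -- a cycle longer by two.
    not-second : h ≁ r
    not-second hr = exchange o h∉ h′∉ hh′ (there (here refl)) (point a ⟨ s ha ⟩ point h ⟨ hr ⟩ T) pa
      (solve 4 (λ q a h R → q ⊕ (a ⊕ (h ⊕ R)) ⊜ h ⊕ (a ⊕ (q ⊕ R))) ↭-refl [ q ] [ a ] [ h ] R)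
      λ z z∉ qz → case z Fin.≟ h of λ where
        (yes z≡h) → z≡h
        (no z≢h)  → ⊥-elim (longer o
          (point z ⟨ s qz ⟩ point q ⟨ s aq ⟩ point a ⟨ s ha ⟩ point h ⟨ hr ⟩ T)
          (neighbours-off z z∉ qz z≢h) [] (z ∷ h ∷ [])
          (solve 5 (λ z q a h R → z ⊕ (q ⊕ (a ⊕ (h ⊕ R))) ⊜ (z ⊕ h) ⊕ (a ⊕ (q ⊕ R))) ↭-refl
            [ z ] [ q ] [ a ] [ h ] R)
          ((z≢h ∷ []) ∷ [] ∷ []) (z∉ ∷ h∉ ∷ []) (s≤s z≤n))

    -- The spider at `a` with legs `h h′`, `q r` and `p`. If `h′` saw `r`, then `h h′` could replace
    -- `q`.
    skip : p ~ r
    skip = s (spider (s ha) hh′ aq qr (s pa) not-second h′≁q h′≁r h′≁p)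
      where
      h′≁r : h′ ≁ r
      h′≁r e = detour o (T ⟨ pa ⟩ point a) (point h ⟨ hh′ ⟩ point h′) (s ha) e (unique₂ hh′)
        (h∉ ∷ h′∉ ∷ []) [ q ]
        (solve 3 (λ q R a → q ⊕ (R ⊕ a) ⊜ a ⊕ (q ⊕ R)) ↭-refl [ q ] R [ a ]) (s≤s (s≤s z≤n))

  -- Cycles split at two vertices.

  ∉-resp-↭ : ∀ {v : V} {l l′} → l ↭ l′ → v ∉ l → v ∉ l′
  ∉-resp-↭ p v∉ = v∉ ∘ ∈-resp-↭ (↭-sym p)

  -- The cycle a F b K, split at two of its vertices into the arcs F from f to f′ and K from k to k′.
  record Ring (a b : V) (F K : List V) (f f′ k k′ : V) : Set where
    field
      optimal : Optimal (a ∷ F ++ b ∷ K)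
      af      : a ~ f
      arcF    : Path f F f′
      f′b     : f′ ~ b
      bk      : b ~ k
      arcK    : Path k K k′
      k′a     : k′ ~ a

  open Ring

  turn : ∀ {a b F K f f′ k k′} → Ring a b F K f f′ k k′ → Ring b a K F k k′ f f′
  turn {F = F} {K} ρ = record
    { optimal = Optimal-resp-↭ (++-comm (_ ∷ F) (_ ∷ K)) (optimal ρ)
    ; af = bk ρ ; arcF = arcK ρ ; f′b = k′a ρ ; bk = af ρ ; arcK = arcF ρ ; k′a = f′b ρ }

  flip-↭ : ∀ (a b : V) F K → a ∷ F ++ b ∷ K ↭ a ∷ K ++ b ∷ F
  flip-↭ a b F K = solve 4 (λ a b F K → a ⊕ (F ⊕ (b ⊕ K)) ⊜ a ⊕ (K ⊕ (b ⊕ F))) ↭-refl [ a ] [ b ] F K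

  flip : ∀ {a b F K f f′ k k′} → Ring a b F K f f′ k k′ → Ring a b K F k′ k f′ f
  flip {a} {b} {F} {K} ρ = record
    { optimal = Optimal-resp-↭ (flip-↭ a b F K) (optimal ρ)
    ; af = s (k′a ρ) ; arcF = reverseᵗ s (arcK ρ) ; f′b = s (bk ρ)
    ; bk = s (f′b ρ) ; arcK = reverseᵗ s (arcF ρ) ; k′a = s (af ρ) }

  -- The cycle is read backwards from `a` as `a k′ k₀ … k b f′ … f`, so `Attached` applies with `k′`
  -- as its `q`, and its `skip` becomes `f ~ k₀`.
  module Penultimate {a b F K f f′ k k′ K₀ k₀} (ρ : Ring a b F K f f′ k k′)
    (K↭ : K ↭ k′ ∷ K₀) (arc₀ : Path k K₀ k₀) (k₀k′ : k₀ ~ k′) where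

    private
      l : List V
      l = a ∷ F ++ b ∷ K

    last-first : l ↭ a ∷ k′ ∷ K₀ ++ b ∷ F
    last-first = ↭-trans (flip-↭ a b F K) (++⁺ (↭-refl {x = [ a ]}) (++⁺ʳ (b ∷ F) K↭))

    module _ {h h′} (h∉ : h ∉ l) (h′∉ : h′ ∉ l) (hh′ : h ~ h′) (ha : h ~ a) where

      open Attached (Optimal-resp-↭ last-first (optimal ρ)) (s (k′a ρ)) (s k₀k′)
        (reverseᵗ s arc₀ ⟨ s (bk ρ) ⟩ point b ⟨ s (f′b ρ) ⟩ reverseᵗ s (arcF ρ)) (s (af ρ))
        (∉-resp-↭ last-first h∉) (∉-resp-↭ last-first h′∉) hh′ ha public

    -- Only `k′` is missed, so closing this path outside the cycle costs a single vertex.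
    bypass : f ~ k₀ → a ~ k → Path a (a ∷ K₀ ++ F ++ [ b ]) b
    bypass fk₀ ak = point a ⟨ ak ⟩ arc₀ ⟨ s fk₀ ⟩ arcF ρ ⟨ f′b ρ ⟩ point b

    bypass-↭ : k′ ∷ a ∷ K₀ ++ F ++ [ b ] ↭ l
    bypass-↭ = ↭-trans
      (solve 5 (λ q a b F K → q ⊕ (a ⊕ (K ⊕ (F ⊕ b))) ⊜ a ⊕ (q ⊕ (K ⊕ (b ⊕ F)))) ↭-refl [ k′ ] [ a ] [ b ] F K₀)
      (↭-sym last-first)

  -- By `skip`, the chord yields the `bypass`, which `h` closes to a cycle with `h` in place of
  -- `k′`. Optimality forbids this unless `k′` has another neighbour `z` off the cycle. Then `z`
  -- sees `f` too, and both `k′` and `z` fit in between `k₀` and `f`.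
  no-short-chord : ∀ {a b F K f f′ k k′ h h′} → Ring a b F K f f′ k k′ →
             h ∉ a ∷ F ++ b ∷ K → h′ ∉ a ∷ F ++ b ∷ K → h ~ h′ → h ~ a → h ~ b → a ≁ k
  no-short-chord {a} {b} {F} {K} {f} {k′ = k′} {h} {h′} ρ h∉ h′∉ hh′ ha hb ak with unsnoc s (arcK ρ)
  -- On an arc of one vertex, `b` is the second vertex after `a`, and `not-second` applies.
  ... | inj₁ (refl , len1) = Attached.not-second
          (Optimal-resp-↭ q (optimal ρ)) (s (k′a ρ)) (s (bk ρ))
          (point b ⟨ s (f′b ρ) ⟩ reverseᵗ s (arcF ρ)) (s (af ρ))
          (∉-resp-↭ q h∉) (∉-resp-↭ q h′∉) hh′ ha hb
    where
    q : a ∷ F ++ b ∷ K ↭ a ∷ k′ ∷ b ∷ F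
    q = subst (λ L → a ∷ F ++ b ∷ K ↭ a ∷ L ++ b ∷ F) (singleton (arcK ρ) len1) (flip-↭ a b F K)
  ... | inj₂ (k₀ , K₀ , arc₀ , k₀k′ , K↭) =
          exchange (optimal ρ) h∉ h′∉ hh′ (∈-resp-↭ (↭-sym last-first) (there (here refl)))
            (point h ⟨ ha ⟩ bypass (skip h∉ h′∉ hh′ ha) ak) (s hb)
            (↭-trans (solve 3 (λ q h M → q ⊕ (h ⊕ M) ⊜ h ⊕ (q ⊕ M)) ↭-refl [ k′ ] [ h ] _) (↭-prep h bypass-↭))
            λ z z∉ k′z → case z Fin.≟ h of λ where
              (yes z≡h) → z≡h
              (no z≢h)  → ⊥-elim (longer (optimal ρ)
                (point h ⟨ ha ⟩ point a ⟨ ak ⟩ arc₀ ⟨ k₀k′ ⟩ point k′ ⟨ k′z ⟩ point z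
                  ⟨ s (neighbours-off h∉ h′∉ hh′ ha z (∉-resp-↭ last-first z∉) k′z z≢h) ⟩ arcF ρ ⟨ f′b ρ ⟩ point b)
                (s hb) [] (z ∷ h ∷ [])
                (↭-trans
                  (solve 7 (λ h a K q z F b →
                      h ⊕ (a ⊕ (K ⊕ (q ⊕ (z ⊕ (F ⊕ b))))) ⊜ (z ⊕ h) ⊕ (q ⊕ (a ⊕ (K ⊕ (F ⊕ b))))) ↭-refl
                    [ h ] [ a ] K₀ [ k′ ] [ z ] F [ b ])
                  (++⁺ˡ (z ∷ h ∷ []) bypass-↭))
                ((z≢h ∷ []) ∷ [] ∷ []) (z∉ ∷ h∉ ∷ []) (s≤s z≤n))
    where open Penultimate ρ K↭ arc₀ k₀k′

  -- The edges `af` and `bk` are given up for `fk`.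
  cross-path : ∀ {a b F K f f′ k k′} → Ring a b F K f f′ k k′ → f ~ k → Path b (a ∷ F ++ b ∷ K) a
  cross-path {a} {b} {F} {K} ρ fk = permute
    (solve 4 (λ a b F K → b ⊕ (F ⊕ (K ⊕ a)) ⊜ a ⊕ (F ⊕ (b ⊕ K))) ↭-refl [ a ] [ b ] F K)
    (point b ⟨ s (f′b ρ) ⟩ reverseᵗ s (arcF ρ) ⟨ fk ⟩ arcK ρ ⟨ k′a ρ ⟩ point a)

  from-f : ∀ {a b F K f f′ k k′} → Ring a b F K f f′ k k′ → Path f (a ∷ F ++ b ∷ K) a
  from-f {a} {b} {F} {K} ρ = permute (++-comm (F ++ b ∷ K) [ a ])
    (permute (solve 4 (λ a b F K → F ⊕ (b ⊕ (K ⊕ a)) ⊜ (F ⊕ (b ⊕ K)) ⊕ a) ↭-refl [ a ] [ b ] F K)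
      (arcF ρ ⟨ f′b ρ ⟩ point b ⟨ bk ρ ⟩ arcK ρ ⟨ k′a ρ ⟩ point a))

  -- The spider at `h` with legs `a f`, `b k` and `h′`. The chords `ak` and `bf` fall to
  -- `no-short-chord`, `fk` to the crossing path closed through `h`, and an edge from `h′` to `f` or
  -- `k` to an insertion of `h h′`.
  one-attachment : ∀ {a b F K f f′ k k′ h h′} → Ring a b F K f f′ k k′ →
                   h ∉ a ∷ F ++ b ∷ K → h′ ∉ a ∷ F ++ b ∷ K → h ~ h′ → h ~ a → h ~ b → ⊥
  one-attachment {a} {b} {F} {K} {f} {f′} {k} {k′} {h} {h′} ρ h∉ h′∉ hh′ ha hb =
    k≁h′ (spider ha (af ρ) hb (bk ρ) hh′ a≁k f≁b f≁k f≁h′)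
    where
    turned = ++-comm (a ∷ F) (b ∷ K)
    a≁k = no-short-chord ρ h∉ h′∉ hh′ ha hb
    f≁b : f ≁ b
    f≁b e = no-short-chord (turn ρ) (∉-resp-↭ turned h∉) (∉-resp-↭ turned h′∉) hh′ hb ha (s e)
    f≁k : f ≁ k
    f≁k e = insert (optimal ρ) (cross-path ρ e) (point h) (s ha) hb ([] ∷ []) (h∉ ∷ [])
    f≁h′ : f ≁ h′
    f≁h′ e = insert (optimal ρ) (from-f ρ) (point h ⟨ hh′ ⟩ point h′) (s ha) (s e) (unique₂ hh′) (h∉ ∷ h′∉ ∷ [])
    k≁h′ : k ≁ h′
    k≁h′ e = insert (optimal (turn ρ)) (from-f (turn ρ)) (point h ⟨ hh′ ⟩ point h′) (s hb) (s e) (unique₂ hh′)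
      (∉-resp-↭ turned h∉ ∷ ∉-resp-↭ turned h′∉ ∷ [])

  -- The arcs are nonempty: P could be inserted between consecutive a and b.
  ring : ∀ {l x y a b h P g} → Optimal l → Path x l y → y ~ x → a ∈ l → b ∈ l → b ≢ a →
         Path h P g → Unique P → Off l P → a ~ h → g ~ b →
         ∃₂ λ F K → ∃₂ λ f f′ → ∃₂ λ k k′ → Ring a b F K f f′ k k′ × a ∷ F ++ b ∷ K ↭ l
  ring {l} {a = a} {b} {h} {P} {g} o (_ , w , perm) e a∈ b∈ b≢a p uP off ah gb =
    ring₀ (rotate w e (∈-resp-↭ (↭-sym perm) a∈))
    where
    rotate : ∀ {x l′ y a} → Walk _~_ x l′ y → y ~ x → a ∈ l′ →
             ∃₂ λ l₁ y₁ → Walk _~_ a l₁ y₁ × y₁ ~ a × l₁ ↭ l′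
    rotate {x} {a = a} w e a∈ with a Fin.≟ x
    ... | yes refl = _ , _ , w , e , ↭-refl
    ... | no a≢x with splitʷ w a∈ a≢x
    ...   | l₁ , l₂ , u , w₁ , ua , w₂ , refl = _ , _ , joinʷ w₂ e w₁ , ua , ++-comm l₂ l₁

    ring₀ : (∃₂ λ l₁ y₁ → Walk _~_ a l₁ y₁ × y₁ ~ a × l₁ ↭ _) → _
    ring₀ (l₁ , y₁ , w , e , q) with splitʷ w (∈-resp-↭ (↭-sym (↭-trans q perm)) b∈) b≢a
    ... | _ , _ , u , stop , ab , w₂ , refl =
          ⊥-elim (insert o (permute (↭-trans (++-comm _ [ a ]) (↭-trans q perm)) (trail w₂ ⟨ e ⟩ point a)) p ah gb uP off)
    ... | _ , _ , u , (_ ∷ _) , ub , stop , refl =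
          ⊥-elim (insert o (permute (↭-trans q perm) (trail w)) (reverseᵗ s p) (s gb) (s ah) uP off)
    ... | _ , _ , u , (af ∷ w₁) , ub , (bk ∷ w₂) , refl =
          _ , _ , _ , _ , _ , _ ,
          record { optimal = Optimal-resp-↭ (↭-sym (↭-trans q perm)) o
                 ; af = af ; arcF = trail w₁ ; f′b = ub ; bk = bk ; arcK = trail w₂ ; k′a = e } ,
          ↭-trans q perm

  -- The layers of the cycle seen from an outside path.

  module Bridge {a b F K f f′ k k′ h g h′ g′ P} (ρ : Ring a b F K f f′ k k′)
    (p : Path h P g) (uP : Unique P) (off : Off (a ∷ F ++ b ∷ K) P) (1<P : 1 < length P)
    (h′∉ : h′ ∉ a ∷ F ++ b ∷ K) (g′∉ : g′ ∉ a ∷ F ++ b ∷ K) (hh′ : h ~ h′) (gg′ : g ~ g′)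
    (ha : h ~ a) (gb : g ~ b)
    (at-h  : ∀ {x} → x ∈ a ∷ F ++ b ∷ K → x ~ h  → x ≡ a)
    (at-h′ : ∀ {x} → x ∈ a ∷ F ++ b ∷ K → x ~ h′ → x ≡ b)
    (at-g  : ∀ {x} → x ∈ a ∷ F ++ b ∷ K → x ~ g  → x ≡ b)
    (at-g′ : ∀ {x} → x ∈ a ∷ F ++ b ∷ K → x ~ g′ → x ≡ a) where

    private
      l : List V
      l = a ∷ F ++ b ∷ K

      h∉ : h ∉ l
      h∉ = All.lookup off (first∈ p)

    -- Otherwise `P`, with at least two vertices, could replace the arc.
    long-arc : length K ≢ 1
    long-arc K1 = detour (optimal ρ) (point a ⟨ af ρ ⟩ arcF ρ ⟨ f′b ρ ⟩ point b) (reverseᵗ s p) (s gb) ha uP off K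
      (solve 4 (λ a b F K → K ⊕ (a ⊕ (F ⊕ b)) ⊜ a ⊕ (F ⊕ (b ⊕ K))) ↭-refl [ a ] [ b ] F K)
      (subst (_< length P) (≡-sym K1) 1<P)

    last-step : ∃₂ λ k₀ K₀ → Path k K₀ k₀ × k₀ ~ k′ × K ↭ k′ ∷ K₀
    last-step with unsnoc s (arcK ρ)
    ... | inj₁ (_ , K1) = ⊥-elim (long-arc K1)
    ... | inj₂ r        = r

    -- The `bypass` closed through `P` loses `k′` and gains at least two vertices.
    no-chord : a ≁ k
    no-chord ak with last-step
    ... | k₀ , K₀ , arc₀ , k₀k′ , K↭ =
      detour (optimal ρ) (bypass (skip h∉ h′∉ hh′ ha) ak) (reverseᵗ s p) (s gb) ha uP off [ k′ ] bypass-↭ 1<P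
      where open Penultimate ρ K↭ arc₀ k₀k′

    -- The levels are distances from h′ in the subgraph induced by h′, h and the cycle without b.
    Inner : V → Set
    Inner x = x ∈ h′ ∷ h ∷ a ∷ F ++ K

    arc→l : ∀ {x} → x ∈ F ++ K → x ∈ l
    arc→l i = ∈-resp-↭ (solve 4 (λ a b F K → (F ⊕ K) ⊕ (a ⊕ b) ⊜ a ⊕ (F ⊕ (b ⊕ K))) ↭-refl [ a ] [ b ] F K)
      (∈-++⁺ˡ i)

    private
      ab-first : l ↭ a ∷ b ∷ F ++ K
      ab-first = solve 4 (λ a b F K → a ⊕ (F ⊕ (b ⊕ K)) ⊜ a ⊕ (b ⊕ (F ⊕ K))) ↭-refl [ a ] [ b ] F K

      uab : Unique (a ∷ b ∷ F ++ K)
      uab = Unique-resp-↭ ab-first (unique (optimal ρ))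

    b∈l : b ∈ l
    b∈l = ∈-++⁺ʳ (a ∷ F) (here refl)

    a≢b : a ≢ b
    a≢b refl = Unique-head uab (here refl)

    arc≢a : ∀ {x} → x ∈ F ++ K → x ≢ a
    arc≢a i refl = Unique-head uab (there i)

    arc≢b : ∀ {x} → x ∈ F ++ K → x ≢ b
    arc≢b i refl with uab
    ... | _ ∷ u = Unique-head u i

    inner≢b : ∀ {x} → Inner x → x ≢ b
    inner≢b (here refl)                 refl = h′∉ b∈l
    inner≢b (there (here refl))         refl = h∉ b∈l
    inner≢b (there (there (here refl))) refl = a≢b refl
    inner≢b (there (there (there i)))   e    = arc≢b i e

    arc-inner : ∀ {x} → x ∈ F ++ K → Inner x
    arc-inner i = there (there (there i))

    open DecMembership (Fin._≟_ {n G}) using (_∈?_)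
    open Layering G Inner (_∈? (h′ ∷ h ∷ a ∷ F ++ K)) h′ (here refl)

    -- On the cycle `h′` can see only `b`, which `Inner` leaves out, and `h` sees only `a`. So the
    -- layering begins with the single vertices `h′`, `h`, `a`.
    level₁ : ∀ {v} → Level 1 v → v ≡ h
    level₁ L with parent L
    ... | _ , (refl , _) , e with level-U L
    ...   | here refl                 = ⊥-elim (irrefl G e)
    ...   | there (here refl)         = refl
    ...   | there (there (here refl)) = ⊥-elim (a≢b (at-h′ (here refl) (s e)))
    ...   | there (there (there i))   = ⊥-elim (arc≢b i (at-h′ (arc→l i) (s e)))

    level₂ : ∀ {v} → Level 2 v → v ≡ a
    level₂ L with parent L
    ... | _ , L₁ , e with level₁ L₁ | level-U L
    ...   | refl | here refl                 = ⊥-elim (proj₂ L (s≤s z≤n) refl)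
    ...   | refl | there (here refl)         = ⊥-elim (irrefl G e)
    ...   | refl | there (there (here refl)) = refl
    ...   | refl | there (there (there i))   = ⊥-elim (arc≢a i (at-h (arc→l i) (s e)))

    walkTo-a : WalkTo 2 a
    walkTo-a = there (there (here refl)) , h , (there (here refl) , h′ , refl , s hh′) , ha

    level-a : Level 2 a
    level-a = walkTo-a , closer
      where
      closer : ∀ {d} → d < 2 → ¬ WalkTo d a
      closer {zero}  _ refl             = h′∉ (here refl)
      closer {suc zero} _ (_ , _ , refl , e) = a≢b (at-h′ (here refl) (s e))
      closer {suc (suc _)} (s≤s (s≤s ()))

    arc-level : ∀ {x d} → x ∈ F ++ K → Level d x → 3 ≤ d
    arc-level {d = 0} i (refl , _) = ⊥-elim (h′∉ (arc→l i))
    arc-level {d = 1} i L          = ⊥-elim (h∉ (subst (_∈ l) (level₁ L) (arc→l i)))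
    arc-level {d = 2} i L          = ⊥-elim (arc≢a i (level₂ L))
    arc-level {d = suc (suc (suc _))} i L = s≤s (s≤s (s≤s z≤n))

    far : ∀ {d e u v} → Level d u → Level e v → suc d < e → u ≁ v
    far p q lt uv = ℕₚ.<⇒≱ lt (level-step p q uv)

    -- By the spider at the grandparent t of v with one leg going back towards h′.
    complete-step : ∀ {d} → (∀ {u v} → Level (2 + d) u → Level (3 + d) v → u ~ v) →
                    ∀ {u v} → Level (3 + d) u → Level (4 + d) v → u ~ v
    complete-step rec p q with parent q
    ... | w , Lw , wv with parent Lw
    ...   | t , Lt , tw with parent Lt
    ...     | t′ , Lt′ , t′t with parent Lt′
    ...       | t″ , Lt″ , t″t′ =
      s (spider (s t′t) (s t″t′) tw wv (rec Lt p)
          (far Lt′ q (ℕₚ.n≤1+n _)) (far Lt″ Lw (ℕₚ.n≤1+n _)) (far Lt″ q (ℕₚ.m≤n+m _ 2)) (far Lt″ p (ℕₚ.n≤1+n _)))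

    -- Up to level 3 the lower vertex is the only one on its level, hence the parent. From then on
    -- the spider needs a leg reaching two levels back from its centre, and this is why the layering
    -- starts at `h′`, two steps before `a`.
    complete : ∀ d {u v} → Level d u → Level (suc d) v → u ~ v
    complete 0 (refl , _) q with parent q
    ... | _ , (refl , _) , e = e
    complete 1 p q with parent q
    ... | w , r , e with level₁ p | level₁ r
    ...   | refl | refl = e
    complete 2 p q with parent q
    ... | w , r , e with level₂ p | level₂ r
    ...   | refl | refl = e
    complete (suc d@(suc (suc _))) p q = complete-step (complete d) p q

    -- A parent of `u` also sees `v` by `complete`, so an edge `uv` would close a triangle.
    independent : ∀ d {u v} → Level d u → Level d v → u ≁ v
    independent zero    (refl , _) (refl , _) e = irrefl G e
    independent (suc d) p q e with parent p
    ... | t , Lt , tu = triangle-free tu e (complete d Lt q)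

    adjacent-levels : ∀ {d e u v} → Level d u → Level e v → u ~ v → suc d ≡ e ⊎ suc e ≡ d
    adjacent-levels {d} {e} p q uv with ℕₚ.<-cmp d e
    ... | tri< d<e _ _  = inj₁ (ℕₚ.≤-antisym d<e (level-step p q uv))
    ... | tri> _ _ e<d  = inj₂ (ℕₚ.≤-antisym e<d (level-step q p (s uv)))
    ... | tri≈ _ refl _ = ⊥-elim (independent d p q uv)

    along : ∀ {x L y v} → Path x L y → a ~ x → (∀ {v} → v ∈ L → Inner v) → v ∈ L → ∃ λ d → Level d v
    along (_ , w , perm) ax sub j = level (proj₂ (walkTo-along w (λ i → sub (∈-resp-↭ perm i))
      (sub (∈-resp-↭ perm (start∈ w)) , a , walkTo-a , ax) (∈-resp-↭ (↭-sym perm) j)))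

    abstract
      -- Each arc avoids `b` and has an end next to `a`, so it is reached from `a` inside `Inner`.
      has-level : ∀ {v} → Inner v → ∃ λ d → Level d v
      has-level (here refl)                 = level {0} refl
      has-level (there (here refl))         = level {1} (there (here refl) , h′ , refl , s hh′)
      has-level (there (there (here refl))) = 2 , level-a
      has-level (there (there (there i))) with ∈-++⁻ F i
      ... | inj₁ j = along (arcF ρ) (af ρ) (λ i → arc-inner (∈-++⁺ˡ i)) j
      ... | inj₂ j = along (reverseᵗ s (arcK ρ)) (s (k′a ρ)) (λ i → arc-inner (∈-++⁺ʳ F i)) j

    inner-cases : ∀ {x} → Inner x → x ≡ h′ ⊎ x ≡ h ⊎ x ≡ a ⊎ x ∈ F ++ K
    inner-cases (here e)                  = inj₁ e
    inner-cases (there (here e))          = inj₂ (inj₁ e)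
    inner-cases (there (there (here e)))  = inj₂ (inj₂ (inj₁ e))
    inner-cases (there (there (there i))) = inj₂ (inj₂ (inj₂ i))

    -- By the spider at b with one leg through g and g′.
    parent-shared : ∀ {u v i} → u ∈ F ++ K → v ∈ F ++ K → b ~ u → b ~ v → a ≁ u → Level (suc i) u →
                    ∃ λ z → z ∈ F ++ K × Level i z × z ~ v
    parent-shared {u} {v} {i} u∈ v∈ bu bv a≁u Lu = shared (parent Lu)
      where
      shared : (∃ λ z → Level i z × z ~ u) → ∃ λ z → z ∈ F ++ K × Level i z × z ~ v
      shared (z , Lz , zu) = z , z∈ (inner-cases (level-U Lz)) , Lz ,
        spider (s gb) gg′ bu (s zu) bv
          (λ e → arc≢b z∈′ (at-g (arc→l z∈′) (s e))) (λ e → arc≢a u∈ (at-g′ (arc→l u∈) (s e)))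
          (λ e → arc≢a z∈′ (at-g′ (arc→l z∈′) (s e))) (λ e → arc≢a v∈ (at-g′ (arc→l v∈) (s e)))
        where
        z∈ : z ≡ h′ ⊎ z ≡ h ⊎ z ≡ a ⊎ z ∈ F ++ K → z ∈ F ++ K
        z∈ (inj₁ refl)               = ⊥-elim (arc≢b u∈ (at-h′ (arc→l u∈) (s zu)))
        z∈ (inj₂ (inj₁ refl))        = ⊥-elim (arc≢a u∈ (at-h (arc→l u∈) (s zu)))
        z∈ (inj₂ (inj₂ (inj₁ refl))) = ⊥-elim (a≁u zu)
        z∈ (inj₂ (inj₂ (inj₂ i)))    = i
        z∈′ : z ∈ F ++ K
        z∈′ = z∈ (inner-cases (level-U Lz))

    -- The parent of `u` that also sees `v` is one level below `u`, and `v` is one level above or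
    -- below it. That parent lies on an arc, hence on level 3 or higher.
    level-or-below : ∀ {u v i j} → u ∈ F ++ K → v ∈ F ++ K → b ~ u → b ~ v → a ≁ u → Level i u → Level j v →
                     3 < i × (j ≡ i ⊎ suc (suc j) ≡ i)
    level-or-below {i = zero} u∈ _ _ _ _ Lu _ with arc-level u∈ Lu
    ... | ()
    level-or-below {i = suc i} u∈ v∈ bu bv a≁u Lu Lv with parent-shared u∈ v∈ bu bv a≁u Lu
    ... | z , z∈ , Lz , zv with adjacent-levels Lz Lv zv
    ...   | inj₁ e = s≤s (arc-level z∈ Lz) , inj₁ (≡-sym e)
    ...   | inj₂ e = s≤s (arc-level z∈ Lz) , inj₂ (cong suc e)

    f′∈ : f′ ∈ F ++ K
    f′∈ = ∈-++⁺ˡ (last∈ (arcF ρ))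

    k∈ : k ∈ F ++ K
    k∈ = ∈-++⁺ʳ F (first∈ (arcK ρ))

    k′∈ : k′ ∈ F ++ K
    k′∈ = ∈-++⁺ʳ F (last∈ (arcK ρ))

    -- Rotating the opened cycle.

    module Closing (a≁f′ : a ≁ f′) where

      abstract
        i : ℕ
        i = proj₁ (has-level (arc-inner k∈))

        Lk : Level i k
        Lk = proj₂ (has-level (arc-inner k∈))

        -- A total level function: whatever is outside `Inner`, in particular `b`, is put just above
        -- `k`. A level below that of `b` thus certifies membership in `Inner`.
        ℓ : V → ℕ
        ℓ v with v ∈? (h′ ∷ h ∷ a ∷ F ++ K)
        ... | yes v∈ = proj₁ (has-level v∈)
        ... | no _   = suc i

        ℓ-level : ∀ {v} → Inner v → Level (ℓ v) v
        ℓ-level {v} v∈ with v ∈? (h′ ∷ h ∷ a ∷ F ++ K)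
        ... | yes v∈′ = proj₂ (has-level v∈′)
        ... | no v∉   = ⊥-elim (v∉ v∈)

        ℓ-outer : ∀ {v} → ¬ Inner v → ℓ v ≡ suc i
        ℓ-outer {v} v∉ with v ∈? (h′ ∷ h ∷ a ∷ F ++ K)
        ... | yes v∈ = ⊥-elim (v∉ v∈)
        ... | no _   = refl

      ℓ≡ : ∀ {v d} → Level d v → ℓ v ≡ d
      ℓ≡ L = level-unique (ℓ-level (level-U L)) L

      ℓ-b : ℓ b ≡ suc i
      ℓ-b = ℓ-outer λ i → inner≢b i refl

      below-b : ∀ {v} → ℓ v < ℓ b → Inner v
      below-b {v} lt with v ∈? (h′ ∷ h ∷ a ∷ F ++ K)
      ... | yes v∈ = v∈
      ... | no v∉  = ⊥-elim (ℕₚ.<-irrefl (trans (ℓ-outer v∉) (≡-sym ℓ-b)) lt)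

      ℓ-complete : ∀ {x y} → suc (ℓ x) ≡ ℓ y → ℓ y < ℓ b → x ~ y
      ℓ-complete {x} {y} eq lt =
        complete (ℓ x) (ℓ-level (below-b (ℕₚ.<-trans (ℕₚ.≤-reflexive eq) lt)))
          (subst (λ d → Level d y) (≡-sym eq) (ℓ-level (below-b lt)))

      open Rotations _~_ s ℓ b ℓ-complete

      edge : ∀ {u v} → Inner u → Inner v → u ~ v → Edge u v
      edge {u} {v} u∈ v∈ uv with adjacent-levels (ℓ-level u∈) (ℓ-level v∈) uv
      ... | inj₁ e = uv , inj₁ (e , inner≢b u∈)
      ... | inj₂ e = uv , inj₂ (e , inner≢b v∈)

      same-level : ∀ {j} → Level j f′ → j ≡ i ⊎ suc (suc j) ≡ i → i ≡ j ⊎ suc (suc i) ≡ j → Level i f′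
      same-level Lj (inj₁ refl) _           = Lj
      same-level Lj (inj₂ _)    (inj₁ refl) = Lj
      same-level Lj (inj₂ e)    (inj₂ e′)   =
        ⊥-elim (ℕₚ.m≢1+n+m _ {n = 3} (trans (≡-sym e′) (cong (2 +_) (≡-sym e))))

      -- `level-or-below` is used in both directions: `f′` and `k` cannot each lie two levels below
      -- the other.
      levels-at-b : 3 < i × Level i f′
      levels-at-b = proj₁ below , same-level (proj₂ Lf′) (proj₂ below)
        (proj₂ (level-or-below f′∈ k∈ (s (f′b ρ)) (bk ρ) a≁f′ (proj₂ Lf′) Lk))
        where
        Lf′ : ∃ λ j → Level j f′
        Lf′ = has-level (arc-inner f′∈)
        below : 3 < i × (proj₁ Lf′ ≡ i ⊎ suc (suc (proj₁ Lf′)) ≡ i)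
        below = level-or-below k∈ f′∈ (bk ρ) (s (f′b ρ)) no-chord Lk (proj₂ Lf′)

      edge-b : ∀ {u} → u ∈ F ++ K → Level i u → u ~ b → Edge u b
      edge-b u∈ L e = e , inj₁ (trans (cong suc (ℓ≡ L)) (≡-sym ℓ-b) , arc≢b u∈)

      a-inner : Inner a
      a-inner = there (there (here refl))

      -- The cycle opened at `a`. Allowing an initial part `M` of the arc makes it possible to drop
      -- `k′`.
      start : ∀ {M y} → Path k M y → (∀ {v} → v ∈ M → v ∈ K) → Trail Edge a (a ∷ F ++ b ∷ M) y
      start t sub =
        point a ⟨ edge a-inner (arc-inner (∈-++⁺ˡ (first∈ (arcF ρ)))) (af ρ) ⟩
        mapᵗ (λ i j → edge (arc-inner (∈-++⁺ˡ i)) (arc-inner (∈-++⁺ˡ j))) (arcF ρ) ⟨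
        edge-b f′∈ (proj₂ levels-at-b) (f′b ρ) ⟩ point b ⟨ Edge-sym (edge-b k∈ Lk (s (bk ρ))) ⟩
        mapᵗ (λ i j → edge (arc-inner (∈-++⁺ʳ F (sub i))) (arc-inner (∈-++⁺ʳ F (sub j)))) t

      rotated : ∀ {M y d} m → Path k M y → (∀ {v} → v ∈ M → v ∈ K) → Level d y → 2 ≤ d →
                ℓ b ≡ suc m * 2 + d → Path a (a ∷ F ++ b ∷ M) b
      rotated m t sub L 2≤d eq = mapᵗ (λ _ _ → proj₁)
        (rotate-to m (start t sub) (∈-++⁺ʳ (a ∷ F) (here refl)) a≢b
          (ℕₚ.≤-trans (ℕₚ.≤-reflexive (ℓ≡ level-a)) (ℕₚ.m≤n⇒m≤1+n (ℕₚ.≤-trans 2≤d (ℕₚ.≤-reflexive (≡-sym (ℓ≡ L))))))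
          (trans eq (cong (suc m * 2 +_) (≡-sym (ℓ≡ L)))))

      next-level : ∀ {d u v} → v ∈ F ++ K → Level d u → v ~ u → (∀ {e} → Level e v → suc e ≢ d) → Level (suc d) v
      next-level {d} {u} {v} v∈ Lu vu not-below = up (has-level (arc-inner v∈))
        where
        up : (∃ λ e → Level e v) → Level (suc d) v
        up (e , Lv) = pick (adjacent-levels Lv Lu vu)
          where
          pick : suc e ≡ d ⊎ suc d ≡ e → Level (suc d) v
          pick (inj₁ eq)   = ⊥-elim (not-below Lv eq)
          pick (inj₂ refl) = Lv

      Lk′ : Level 3 k′
      Lk′ = next-level k′∈ level-a (k′a ρ)
        λ L eq → ℕₚ.<⇒≱ (arc-level k′∈ L) (ℕₚ.≤-trans (ℕₚ.≤-reflexive (ℕₚ.suc-injective eq)) (s≤s z≤n))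

      parity : ∀ t → ∃ λ m → t ≡ m * 2 ⊎ t ≡ suc (m * 2)
      parity zero    = 0 , inj₁ refl
      parity (suc t) with parity t
      ... | m , inj₁ e = m , inj₂ (cong suc e)
      ... | m , inj₂ e = suc m , inj₁ (cong suc e)

      -- `k′` lies an even number of levels below `b`, so the whole opened cycle is rotated and no
      -- vertex is lost.
      even-gap : ∀ m → ℓ b ≡ suc m * 2 + 3 → ⊥
      even-gap m eq =
        detour (optimal ρ) (rotated m (arcK ρ) (λ i → i) Lk′ (s≤s (s≤s z≤n)) eq)
          (reverseᵗ s p) (s gb) ha uP off [] ↭-refl (ℕₚ.<-trans (s≤s z≤n) 1<P)

      -- Dropping `k′` mends the parity, as the path then ends in `k₀` on level 4. The two or more
      -- vertices of `P` outweigh the loss.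
      odd-gap : ∀ m → ℓ b ≡ suc m * 2 + 4 → (∃₂ λ k₀ K₀ → Path k K₀ k₀ × k₀ ~ k′ × K ↭ k′ ∷ K₀) → ⊥
      odd-gap m eq (k₀ , K₀ , arc₀ , k₀k′ , K↭) =
        detour (optimal ρ) (rotated m arc₀ sub L₀ (s≤s (s≤s z≤n)) eq)
          (reverseᵗ s p) (s gb) ha uP off [ k′ ]
          (↭-trans (solve 5 (λ q a F b K → q ⊕ (a ⊕ (F ⊕ (b ⊕ K))) ⊜ a ⊕ (F ⊕ (b ⊕ (q ⊕ K)))) ↭-refl
                     [ k′ ] [ a ] F [ b ] K₀)
            (++⁺ˡ (a ∷ F) (↭-prep b (↭-sym K↭))))
          1<P
        where
        sub : ∀ {v} → v ∈ K₀ → v ∈ K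
        sub i = ∈-resp-↭ (↭-sym K↭) (there i)
        k₀∈ : k₀ ∈ F ++ K
        k₀∈ = ∈-++⁺ʳ F (sub (last∈ arc₀))
        L₀ : Level 4 k₀
        L₀ = next-level k₀∈ Lk′ k₀k′
          λ L eq → ℕₚ.<⇒≢ (arc-level k₀∈ L) (≡-sym (ℕₚ.suc-injective eq))

      gap : ∀ d t → t + suc d ≡ i → ℓ b ≡ suc (suc t) + d
      gap d t eq = trans ℓ-b (cong suc (trans (≡-sym eq) (ℕₚ.+-suc t d)))

      contradiction : ⊥
      -- With `i` written as `4 + t`, `b` lies `t + 2` levels above `k′` and `t + 1` above `k₀`, so
      -- the parity of `t` decides which of them serves as free end.
      contradiction = by-parity (ℕₚ.m≤n⇒∃[o]m+o≡n (proj₁ levels-at-b))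
        where
        by-parity : (∃ λ t → 4 + t ≡ i) → ⊥
        by-parity (t , eq) = cases (parity t)
          where
          cases : (∃ λ m → t ≡ m * 2 ⊎ t ≡ suc (m * 2)) → ⊥
          cases (m , inj₁ even) = even-gap m (gap 3 (m * 2)
            (trans (ℕₚ.+-comm (m * 2) 4) (trans (cong (4 +_) (≡-sym even)) eq)))
          cases (m , inj₂ odd)  = odd-gap m (gap 4 (m * 2)
            (trans (ℕₚ.+-comm (m * 2) 5) (trans (cong (4 +_) (≡-sym odd)) eq))) last-step

  -- The hypothesis `a ≁ f′` of `Closing` is `no-chord` for the cycle traversed in reverse.
  bridge : ∀ {a b F K f f′ k k′ h g h′ g′ P} (ρ : Ring a b F K f f′ k k′) →
    Path h P g → Unique P → Off (a ∷ F ++ b ∷ K) P → 1 < length P →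
    h′ ∉ a ∷ F ++ b ∷ K → g′ ∉ a ∷ F ++ b ∷ K → h ~ h′ → g ~ g′ → h ~ a → g ~ b →
    (∀ {x} → x ∈ a ∷ F ++ b ∷ K → x ~ h  → x ≡ a) → (∀ {x} → x ∈ a ∷ F ++ b ∷ K → x ~ h′ → x ≡ b) →
    (∀ {x} → x ∈ a ∷ F ++ b ∷ K → x ~ g  → x ≡ b) → (∀ {x} → x ∈ a ∷ F ++ b ∷ K → x ~ g′ → x ≡ a) → ⊥
  bridge {a} {b} {F} {K} ρ p uP off 1<P h′∉ g′∉ hh′ gg′ ha gb at-h at-h′ at-g at-g′ =
    Bridge.Closing.contradiction ρ p uP off 1<P h′∉ g′∉ hh′ gg′ ha gb at-h at-h′ at-g at-g′
      (Bridge.no-chord (flip ρ) p uP (All.map to off) 1<P (to h′∉) (to g′∉) hh′ gg′ ha gb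
        (at-h ∘ from) (at-h′ ∘ from) (at-g ∘ from) (at-g′ ∘ from))
    where
    to : ∀ {v} → v ∉ a ∷ F ++ b ∷ K → v ∉ a ∷ K ++ b ∷ F
    to = ∉-resp-↭ (flip-↭ a b F K)
    from : ∀ {v} → v ∈ a ∷ K ++ b ∷ F → v ∈ a ∷ F ++ b ∷ K
    from = ∈-resp-↭ (flip-↭ a b K F)

  -- Strong induction on the length of `P`: any other attachment of its first or last two vertices
  -- would give a shorter such path. The neighbour `h′` is carried along because a one-vertex path
  -- does not supply one.
  no-bridge : ∀ {l x y} → Optimal l → Path x l y → y ~ x → ∀ m {a b h g h′ P} → length P ≡ m →
              Path h P g → Unique P → Off l P → h′ ∉ l → h ~ h′ →
              a ∈ l → b ∈ l → b ≢ a → a ~ h → g ~ b → ⊥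
  no-bridge {l} o t e = <-rec _ step′
    where
    Claim : ℕ → Set
    Claim m = ∀ {a b h g h′ P} → length P ≡ m → Path h P g → Unique P → Off l P → h′ ∉ l → h ~ h′ →
              a ∈ l → b ∈ l → b ≢ a → a ~ h → g ~ b → ⊥
    step′ : ∀ m → (∀ {j} → j < m → Claim j) → Claim m
    step′ m rec {a} {b} {h} {g} {h′} {P} refl p uP off h′∉ hh′ a∈ b∈ b≢a ah gb
      with ring o t e a∈ b∈ b≢a p uP off ah gb
    ... | F , K , f , f′ , k , k′ , ρ , ρ↭ with uncons p | unsnoc s p
    ...   | inj₁ (refl , _) | _ = one-attachment ρ (out (All.lookup off (first∈ p))) (out h′∉) hh′ (s ah) gb
      where
      out : ∀ {v} → v ∉ l → v ∉ a ∷ F ++ b ∷ K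
      out = ∉-resp-↭ (↭-sym ρ↭)
    ...   | inj₂ _ | inj₁ (refl , _) = one-attachment ρ (out (All.lookup off (first∈ p))) (out h′∉) hh′ (s ah) gb
      where
      out : ∀ {v} → v ∉ l → v ∉ a ∷ F ++ b ∷ K
      out = ∉-resp-↭ (↭-sym ρ↭)
    ...   | inj₂ (h₁ , P₁ , hh₁ , p₁ , P↭₁) | inj₂ (g₁ , P₂ , p₂ , g₁g , P↭₂) =
      bridge ρ p uP (All.map out off) 1<P (out h₁∉) (out g₁∉) hh₁ (s g₁g) (s ah) gb
        (λ x∈ xh → only λ x≢a → rec 1<P refl (point h) ([] ∷ []) (h∉ ∷ []) h₁∉ hh₁
          a∈ (∈-resp-↭ ρ↭ x∈) x≢a ah (s xh))
        -- `P` without `h` would join `x` to `b`, and `h` itself serves as the neighbour off the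
        -- cycle.
        (λ x∈ xh₁ → only λ x≢b → rec (shorter P↭₁) refl p₁ (proj₁ (tail P↭₁)) (proj₂ (tail P↭₁)) h∉ (s hh₁)
          (∈-resp-↭ ρ↭ x∈) b∈ (x≢b ∘ ≡-sym) xh₁ gb)
        (λ x∈ xg → only λ x≢b → rec 1<P refl (point g) ([] ∷ []) (g∉ ∷ []) g₁∉ (s g₁g)
          b∈ (∈-resp-↭ ρ↭ x∈) x≢b (s gb) (s xg))
        (λ x∈ xg₁ → only λ x≢a → rec (shorter P↭₂) refl (reverseᵗ s p₂) (proj₁ (tail P↭₂)) (proj₂ (tail P↭₂)) g∉ g₁g
          (∈-resp-↭ ρ↭ x∈) a∈ (x≢a ∘ ≡-sym) xg₁ (s ah))
      where
      out : ∀ {v} → v ∉ l → v ∉ a ∷ F ++ b ∷ K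
      out = ∉-resp-↭ (↭-sym ρ↭)
      h∉ = All.lookup off (first∈ p)
      g∉ = All.lookup off (last∈ p)
      h₁∉ = All.lookup off (∈-resp-↭ (↭-sym P↭₁) (there (first∈ p₁)))
      g₁∉ = All.lookup off (∈-resp-↭ (↭-sym P↭₂) (there (last∈ p₂)))
      shorter : ∀ {v M} → P ↭ v ∷ M → length M < length P
      shorter q = ℕₚ.≤-reflexive (≡-sym (↭-length q))
      1<P : 1 < length P
      1<P = subst (1 <_) (≡-sym (↭-length P↭₁)) (s≤s (nonempty p₁))
      tail : ∀ {v M} → P ↭ v ∷ M → Unique M × Off l M
      tail q with Unique-resp-↭ q uP
      ... | _ ∷ u = u , All.tabulate λ i → All.lookup off (∈-resp-↭ (↭-sym q) (there i))
      only : ∀ {x c : V} → (x ≢ c → ⊥) → x ≡ c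
      only {x} {c} f with x Fin.≟ c
      ... | yes e = e
      ... | no x≢c = ⊥-elim (f x≢c)

-- Existence of an optimal cycle.

module _ {A : Set} where

  lookup-injective : {l : List A} → Unique l → ∀ {i j} → lookup l i ≡ lookup l j → i ≡ j
  lookup-injective (_ ∷ _) {zero}  {zero}  _ = refl
  lookup-injective (a ∷ _) {zero}  {suc j} e = ⊥-elim (All.lookup a (∈-lookup j) e)
  lookup-injective (a ∷ _) {suc i} {zero}  e = ⊥-elim (All.lookup a (∈-lookup i) (≡-sym e))
  lookup-injective (_ ∷ u) {suc i} {suc j} e = cong suc (lookup-injective u e)

  module _ {P Q : A → Set} (P? : Decidable P) (Q? : Decidable Q) (P⇒Q : ∀ {x} → P x → Q x) where

    length-filter-mono : ∀ xs → length (filter P? xs) ≤ length (filter Q? xs)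
    length-filter-mono [] = z≤n
    length-filter-mono (x ∷ xs) with P? x | Q? x
    ... | yes p | yes q = s≤s (length-filter-mono xs)
    ... | yes p | no ¬q = ⊥-elim (¬q (P⇒Q p))
    ... | no ¬p | yes q = ℕₚ.m≤n⇒m≤1+n (length-filter-mono xs)
    ... | no ¬p | no ¬q = length-filter-mono xs

    length-filter-strict : ∀ {x xs} → x ∈ xs → Q x → ¬ P x → length (filter P? xs) < length (filter Q? xs)
    length-filter-strict {x} {_ ∷ xs} (here refl) q ¬p with P? x | Q? x
    ... | yes p | _     = ⊥-elim (¬p p)
    ... | no _  | yes _ = s≤s (length-filter-mono xs)
    ... | no _  | no ¬q = ⊥-elim (¬q q)
    length-filter-strict {xs = y ∷ xs} (there i) q ¬p with P? y | Q? y
    ... | yes p | yes _ = s≤s (length-filter-strict i q ¬p)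
    ... | yes p | no ¬q = ⊥-elim (¬q (P⇒Q p))
    ... | no _  | yes _ = ℕₚ.m≤n⇒m≤1+n (length-filter-strict i q ¬p)
    ... | no _  | no _  = length-filter-strict i q ¬p

anyList? : ∀ {m} {P : List (Fin m) → Set} → Decidable P → ∀ k → Dec (∃ λ l → length l ≡ k × P l)
anyList? P? zero = map′ (λ p → [] , refl , p) (λ { ([] , _ , p) → p }) (P? [])
anyList? P? (suc k) = map′
  (λ { (x , l , e , p) → x ∷ l , cong suc e , p })
  (λ { (x ∷ l , e , p) → x , l , ℕₚ.suc-injective e , p })
  (Finₚ.any? λ x → anyList? (λ l → P? (x ∷ l)) k)

module Cycles (G : Graph) where

  open Optimality G
  open DecMembership (Fin._≟_ {n G}) using (_∈?_; _∉?_)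
  open DecUnique (Fin._≟_ {n G}) using (unique?)

  record IsCycle (l : List V) : Set where
    constructor isCycle
    field
      long     : 3 ≤ length l
      distinct : Unique l
      {x y}    : V
      walk     : Walk _~_ x l y
      closing  : y ~ x

  walk? : ∀ x l y → Dec (Walk _~_ x l y)
  walk? x [] y = no λ ()
  walk? x (z ∷ []) y with x Fin.≟ z | x Fin.≟ y
  ... | yes refl | yes refl = yes stop
  ... | no x≢z   | _        = no λ { stop → x≢z refl ; (_ ∷ ()) }
  ... | _        | no x≢y   = no λ { stop → x≢y refl ; (_ ∷ ()) }
  walk? x (z ∷ z′ ∷ l) y with x Fin.≟ z | dec G x z′ | walk? z′ (z′ ∷ l) y
  ... | yes refl | yes e | yes w = yes (e ∷ w)
  ... | no x≢z   | _     | _     = no λ { (_ ∷ _) → x≢z refl }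
  ... | _        | no ¬e | _     = no λ { (e ∷ stop) → ¬e e ; (e ∷ (_ ∷ _)) → ¬e e }
  ... | _        | _     | no ¬w = no λ { (_ ∷ stop) → ¬w stop ; (_ ∷ (e ∷ w)) → ¬w (e ∷ w) }

  isCycle? : Decidable IsCycle
  isCycle? l = map′ (λ (s , u , x , y , w , e) → isCycle s u w e) (λ (isCycle s u w e) → s , u , _ , _ , w , e)
    (3 ℕₚ.≤? length l ×-dec unique? l ×-dec
      Finₚ.any? λ x → Finₚ.any? λ y → walk? x l y ×-dec dec G y x)

  OuterEdge : List V → V → Set
  OuterEdge l v = v ∉ l × ∃ λ u → u ∉ l × v ~ u

  outerEdge? : ∀ l → Decidable (OuterEdge l)
  outerEdge? l v = (v ∉? l) ×-dec Finₚ.any? λ u → (u ∉? l) ×-dec dec G v u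

  outer : List V → ℕ
  outer l = length (filter (outerEdge? l) (allFin (n G)))

  length≤n : ∀ {l} → Unique l → length l ≤ n G
  length≤n u = Finₚ.injective⇒≤ (lookup-injective u)

  -- Two minimisations: first of the shortfall `n G ∸ length l`, which maximises the length, then of
  -- `outer` among the cycles of that length.
  optimal-cycle : ∃ IsCycle → ∃ λ l → IsCycle l × Optimal l
  optimal-cycle (l₀ , c₀) with least longest? {n G ∸ length l₀}
                                 (l₀ , ≡-sym (ℕₚ.m∸[m∸n]≡n (length≤n (IsCycle.distinct c₀))) , c₀)
    where
    longest? : Decidable (λ d → ∃ λ l → length l ≡ n G ∸ d × IsCycle l)
    longest? d = anyList? isCycle? (n G ∸ d)
  ... | d , (l₁ , len₁ , c₁) , shortfall with least (λ t → anyList? (λ l → isCycle? l ×-dec (outer l ℕₚ.≟ t)) (n G ∸ d))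
                                         (l₁ , len₁ , c₁ , refl)
  ...   | _ , (l , len≡ , c , refl) , fewest = l , c , record
    { unique   = IsCycle.distinct c
    ; size     = IsCycle.long c
    ; longest  = λ (l′ , w , p) e u s → subst (_≤ length l) (↭-length p)
        (maximal (isCycle (subst (3 ≤_) (≡-sym (↭-length p)) s) (Unique-resp-↭ (↭-sym p) u) w e))
    ; exchange = exchange
    }
    where
    maximal : ∀ {l′} → IsCycle l′ → length l′ ≤ length l
    maximal {l′} c′ = subst (_≤ length l) (ℕₚ.m∸[m∸n]≡n bound)
      (subst (n G ∸ (n G ∸ length l′) ≤_) (≡-sym len≡)
        (ℕₚ.∸-monoʳ-≤ (n G) (ℕₚ.≮⇒≥ λ lt → shortfall {n G ∸ length l′} lt (l′ , ≡-sym (ℕₚ.m∸[m∸n]≡n bound) , c′))))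
      where
      bound : length l′ ≤ n G
      bound = length≤n (IsCycle.distinct c′)
    -- `h` leaves the count because it is on the new cycle. `w` does not enter it, since its only
    -- neighbour off `l` was `h`, and it makes no other vertex enter either.
    exchange : ∀ {h h′ w x y l′} → h ∉ l → h′ ∉ l → h ~ h′ → w ∈ l → Path x l′ y → y ~ x →
               w ∷ l′ ↭ h ∷ l → (∀ z → z ∉ l → w ~ z → z ≡ h) → ⊥
    exchange {h} {h′} {w} {l′ = l′} h∉ h′∉ hh′ w∈ (l″ , walk , p) e q only-h =
      fewest (length-filter-strict (outerEdge? l″) (outerEdge? l) shrink (∈-allFin h) (h∉ , h′ , h′∉ , hh′)
               λ (h∉″ , _) → h∉″ h∈″)
        (l″ , trans same len≡ ,
          isCycle (subst (3 ≤_) (≡-sym same) (IsCycle.long c)) (Unique-++ʳ [ w ] (Unique-resp-↭ (↭-sym q″) uhl)) walk e , refl)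
      where
      q″ : w ∷ l″ ↭ h ∷ l
      q″ = ↭-trans (↭-prep w p) q
      same : length l″ ≡ length l
      same = ℕₚ.suc-injective (↭-length q″)
      uhl : Unique (h ∷ l)
      uhl = Unique-∷ h∉ (IsCycle.distinct c)
      in″ : ∀ {v} → v ∈ h ∷ l → v ≢ w → v ∈ l″
      in″ v∈ v≢w with ∈-resp-↭ (↭-sym q″) v∈
      ... | here v≡w = ⊥-elim (v≢w v≡w)
      ... | there i  = i
      h∈″ : h ∈ l″
      h∈″ = in″ (here refl) λ { refl → h∉ w∈ }
      out : ∀ {v} → v ∉ l″ → v ≢ w → v ∉ l
      out v∉ v≢w i = v∉ (in″ (there i) v≢w)
      not-w : ∀ {v u} → v ∉ l″ → u ∉ l″ → v ~ u → v ≢ w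
      not-w {u = u} _ u∉ vu refl = u∉ (subst (_∈ l″) (≡-sym (only-h u (out u∉ (~⇒≢ (sym G vu))) vu)) h∈″)
      shrink : ∀ {v} → OuterEdge l″ v → OuterEdge l v
      shrink (v∉ , u , u∉ , vu) = out v∉ (not-w v∉ u∉ vu) , u , out u∉ (not-w u∉ v∉ (sym G vu)) , vu

  -- Translation between lists and the record `Cycle`.

  lookup-step : ∀ {x l y} → Walk _~_ x l y → ∀ i j → suc (toℕ i) ≡ toℕ j → lookup l i ~ lookup l j
  lookup-step stop          zero    (suc ()) _
  lookup-step (e ∷ stop)    zero    (suc zero) _ = e
  lookup-step (e ∷ (_ ∷ _)) zero    (suc zero) _ = e
  lookup-step (e ∷ w)       (suc i) (suc j) eq = lookup-step w i j (ℕₚ.suc-injective eq)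

  lookup-first : ∀ {x l y} → Walk _~_ x l y → ∀ j → toℕ j ≡ 0 → lookup l j ≡ x
  lookup-first stop    zero _ = refl
  lookup-first (_ ∷ _) zero _ = refl

  lookup-last : ∀ {x l y} → Walk _~_ x l y → ∀ i → suc (toℕ i) ≡ length l → lookup l i ≡ y
  lookup-last stop          zero    _  = refl
  lookup-last (_ ∷ stop)    zero    ()
  lookup-last (_ ∷ (_ ∷ _)) zero    ()
  lookup-last (_ ∷ w)       (suc i) eq = lookup-last w i (ℕₚ.suc-injective eq)

  toCycle : ∀ {l} → IsCycle l → Cycle G
  toCycle {l} (isCycle s u {x} {y} w e) = record
    { len = length l ; len≥3 = s ; vert = lookup l ; inj = lookup-injective u ; next = lookup-step w
    ; close = λ i j p q → subst (_~ lookup l j) (≡-sym (lookup-last w i p)) (subst (y ~_) (≡-sym (lookup-first w j q)) e) }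

  tabulate-walk : ∀ {m} (f : Fin (suc m) → V) → (∀ i j → suc (toℕ i) ≡ toℕ j → f i ~ f j) →
                  Walk _~_ (f zero) (tabulate f) (f (fromℕ m))
  tabulate-walk {zero}  f adj = stop
  tabulate-walk {suc m} f adj =
    adj zero (suc zero) refl ∷ tabulate-walk (f ∘ suc) λ i j e → adj (suc i) (suc j) (cong suc e)

  fromCycle : (D : Cycle G) → ∃ λ l → IsCycle l × length l ≡ len D
  fromCycle record { len = suc m ; len≥3 = s ; vert = f ; inj = inj ; next = next ; close = close } =
    tabulate f , isCycle (subst (3 ≤_) (≡-sym (length-tabulate f)) s) (tabulate⁺ inj) (tabulate-walk f next)
      (close (fromℕ m) zero (cong suc (Finₚ.toℕ-fromℕ m)) refl) , length-tabulate f

  -- Cycles and attachments from 2-connectedness.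

  reach-start : ∀ {P u v} → Reach G P u v → P u
  reach-start (here p)     = p
  reach-start (step p _ _) = p

  reach-walk : ∀ {P u v} → Reach G P u v → ∃ λ l → Walk _~_ u l v × All P l
  reach-walk (here p) = _ , stop , p ∷ []
  reach-walk (step p e r) with reach-walk r
  ... | l , w , ps = _ , e ∷ w , p ∷ ps

  -- Given an edge `ab`, a third vertex is reached from `a` avoiding `b`, so `a` has a second
  -- neighbour `c`. A path from `c` to `b` avoiding `a` closes the cycle.
  some-cycle : TwoConnected G → ∃ IsCycle
  some-cycle (3≤n , connected , 2-connected) = first-edge (connected (v zero) (v (suc zero)))
    where
    v : Fin 3 → V
    v = λ i → Fin.inject≤ i 3≤n
    distinct : ∀ {i j} → v i ≡ v j → i ≡ j
    distinct = Finₚ.inject≤-injective 3≤n 3≤n _ _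
    a : V
    a = v zero
    third : ∀ b → ∃ λ t → t ≢ a × t ≢ b
    third b with b Fin.≟ v (suc zero)
    ... | no b≢  = v (suc zero) , (λ e → Finₚ.0≢1+n (≡-sym (distinct e))) , b≢ ∘ ≡-sym
    ... | yes refl = v (suc (suc zero)) , (λ e → Finₚ.0≢1+n (≡-sym (distinct e))) ,
      λ e → Finₚ.0≢1+n (≡-sym (Finₚ.suc-injective (distinct e)))
    close-up : ∀ {b c} → a ~ b → a ~ c → c ≢ b → ∃ IsCycle
    close-up {b} {c} ab ac c≢b with reach-walk (2-connected a c b (~⇒≢ (sym G ac)) (~⇒≢ (sym G ab)))
    ... | l , w , ps with eraseLoops Fin._≟_ w
    ...   | l′ , w′ , u , sub = a ∷ l′ ,
            isCycle (s≤s (two w′)) (Unique-∷ (λ a∈ → All.lookup ps (sub a∈) refl) u) (ac ∷ w′) (sym G ab)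
      where
      two : ∀ {l} → Walk _~_ c l b → 2 ≤ length l
      two stop          = ⊥-elim (c≢b refl)
      two (_ ∷ stop)    = s≤s (s≤s z≤n)
      two (_ ∷ (_ ∷ _)) = s≤s (s≤s z≤n)
    second-edge : ∀ {b t} → a ~ b → t ≢ a → Reach G (_≢ b) a t → ∃ IsCycle
    second-edge ab t≢a (here _)     = ⊥-elim (t≢a refl)
    second-edge ab t≢a (step _ e r) = close-up ab e (reach-start r)
    first-edge : ∀ {P} → Reach G P a (v (suc zero)) → ∃ IsCycle
    first-edge {P} r = go r refl
      where
      go : ∀ {t} → Reach G P a t → t ≡ v (suc zero) → ∃ IsCycle
      go (here _) e = ⊥-elim (Finₚ.0≢1+n (distinct e))
      go (step {w = b} _ ab _) _ with third b
      ... | t , t≢a , t≢b = second-edge ab t≢a (2-connected b a t (~⇒≢ ab) t≢b)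

  -- The walk is cut at its first vertex on `l`. The property `P` is retained there to make a second
  -- attachment differ from the first.
  attachment : ∀ {l P u v} → Reach G P u v → u ∉ l → v ∈ l →
               ∃₂ λ q c → c ∈ l × P c × q ~ c × ∃ λ W → Walk _~_ u W q × All (_∉ l) W
  attachment (here _) u∉ v∈ = ⊥-elim (u∉ v∈)
  attachment {l} (step {w = w} _ e r) u∉ v∈ with w ∈? l
  ... | yes w∈ = _ , _ , w∈ , reach-start r , e , _ , stop , u∉ ∷ []
  ... | no w∉ with attachment r w∉ v∈
  ...   | q , c , c∈ , Pc , qc , W , walk , off = q , c , c∈ , Pc , qc , _ , e ∷ walk , u∉ ∷ off

  module _ {l : List V} where

    -- The predecessor of `q` on the walk, or the given vertex when the walk is trivial.
    off-neighbour : ∀ {h W q} → Walk _~_ h W q → All (_∉ l) W → (∃ λ h′ → h′ ∉ l × h ~ h′) →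
                    ∃ λ q′ → q′ ∉ l × q ~ q′
    off-neighbour stop    _          r = r
    off-neighbour (e ∷ w) (h∉ ∷ off) r = off-neighbour w off (_ , h∉ , sym G e)

    connect : ∀ {h q r W₁ W₂} → Walk _~_ h W₁ q → All (_∉ l) W₁ → Walk _~_ h W₂ r → All (_∉ l) W₂ →
              ∃ λ W → Walk _~_ q W r × All (_∉ l) W
    connect stop    _          w₂ off₂ = _ , w₂ , off₂
    connect (e ∷ w) (h∉ ∷ off) w₂ off₂ = connect w off (sym G e ∷ w₂) (All.lookup off (start∈ w) ∷ off₂)

  module _ (triangle-free : TriangleFree G) (spider : SpiderClosed G) (2-connected : TwoConnected G) where

    -- A walk from `h` first meets the cycle in some `a`, and one avoiding `a` meets it in another
    -- vertex `b`. Their parts off the cycle, joined at `h` and freed of loops, form a path that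
    -- `no-bridge` excludes.
    dominates : ∀ {l} → IsCycle l → Optimal l → ∀ {h h′} → h ~ h′ → h ∉ l → h′ ∉ l → ⊥
    dominates {l} c o {h} {h′} hh′ h∉ h′∉ = attach₁ (attachment (proj₁ (proj₂ 2-connected) h (IsCycle.x c)) h∉ x∈)
      where
      x∈ : IsCycle.x c ∈ l
      x∈ = start∈ (IsCycle.walk c)
      y∈ : IsCycle.y c ∈ l
      y∈ = end∈ (IsCycle.walk c)
      other : ∀ a → ∃ λ b → b ∈ l × b ≢ a
      other a with IsCycle.x c Fin.≟ a
      ... | no x≢a   = _ , x∈ , x≢a
      ... | yes refl = _ , y∈ , ~⇒≢ (IsCycle.closing c)
      attach₁ : (∃₂ λ q a → a ∈ l × _ × q ~ a × ∃ λ W → Walk _~_ h W q × All (_∉ l) W) → ⊥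
      attach₁ (q , a , a∈ , _ , qa , W₁ , w₁ , off₁) with other a
      ... | t , t∈ , t≢a with attachment (proj₂ (proj₂ 2-connected) a h t (λ { refl → h∉ a∈ }) t≢a) h∉ t∈
      ...   | r , b , b∈ , b≢a , rb , W₂ , w₂ , off₂ with connect w₁ off₁ w₂ off₂
      ...     | W , w , off with eraseLoops Fin._≟_ w | off-neighbour w₁ off₁ (h′ , h′∉ , hh′)
      ...       | P , p , uP , sub | q′ , q′∉ , qq′ =
        Clawless.no-bridge G triangle-free spider o (trail (IsCycle.walk c)) (IsCycle.closing c) _ refl
          (trail p) uP (All.tabulate λ i → All.lookup off (sub i)) q′∉ qq′ a∈ b∈ b≢a (sym G qa) rb

  -- Two consecutive vertices of the cycle each see `h` or `h′`, so `h`, `h′` or the edge `hh′` can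
  -- be inserted between them.
  seen-everywhere : ∀ {l} → IsCycle l → Optimal l → ∀ {h h′} → h ~ h′ → h ∉ l → h′ ∉ l →
                    ¬ (∀ w → w ~ h ⊎ w ~ h′)
  seen-everywhere (isCycle s u stop e) o hh′ h∉ h′∉ sees = irrefl G e
  seen-everywhere (isCycle s u {x} (_∷_ {y = y} {l = l} xy w) e) o {h} {h′} hh′ h∉ h′∉ sees = cases (sees x) (sees y)
    where
    open-up : Path y (x ∷ l) x
    open-up = permute (++-comm l [ x ]) (trail w ⟨ e ⟩ point x)
    cases : x ~ h ⊎ x ~ h′ → y ~ h ⊎ y ~ h′ → ⊥
    cases (inj₁ xh)  (inj₁ yh)  = insert o open-up (point h) xh (sym G yh) ([] ∷ []) (h∉ ∷ [])
    cases (inj₂ xh′) (inj₂ yh′) = insert o open-up (point h′) xh′ (sym G yh′) ([] ∷ []) (h′∉ ∷ [])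
    cases (inj₁ xh)  (inj₂ yh′) = insert o open-up (point h ⟨ hh′ ⟩ point h′) xh (sym G yh′) (unique₂ hh′) (h∉ ∷ h′∉ ∷ [])
    cases (inj₂ xh′) (inj₁ yh)  =
      insert o open-up (point h′ ⟨ sym G hh′ ⟩ point h) xh′ (sym G yh) (unique₂ (sym G hh′)) (h′∉ ∷ h∉ ∷ [])

  dominating-longest : TwoConnected G → Free K13** G → Free Z1 G → Σ (Cycle G) λ C → Longest C × Dominating C
  dominating-longest 2-connected clawless pawfree with optimal-cycle (some-cycle 2-connected)
  ... | l , c , o = toCycle c , longest , dominating
    where
    longest : Longest (toCycle c)
    longest D with fromCycle D
    ... | l′ , isCycle s u w e , len≡ = subst (_≤ length l) len≡ (Optimal.longest o (trail w) e u s)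
    on : ∀ {v} → v ∈ l → OnCycle (toCycle c) v
    on v∈ = Any.index v∈ , ≡-sym (lookup-index v∈)
    dominating : Dominating (toCycle c)
    dominating u v uv with u ∈? l | v ∈? l
    ... | yes u∈ | _      = inj₁ (on u∈)
    ... | no _   | yes v∈ = inj₂ (on v∈)
    ... | no u∉  | no v∉  = ⊥-elim (dominates triangle-free (spider-closed G clawless triangle-free)
                                      2-connected c o uv u∉ v∉)
      where
      -- This relies on the edge `uv` off the cycle: given a triangle, every vertex would see `u` or
      -- `v`.
      triangle-free : TriangleFree G
      triangle-free xy yz xz = seen-everywhere c o uv u∉ v∉
        (Multipartite.edge-dominates G (proj₁ (proj₂ 2-connected)) pawfree xy yz xz uv)

theorem5 : (G : Graph) → TwoConnected G → Free K13** G → Free Z1 G →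
    Σ (Cycle G) λ C → Longest C × Dominating C
theorem5 G = Cycles.dominating-longest G
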